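{- Consider the synchronous self-jamming singing protocol on a dynamic network, and let ${\cal E}_i$ denote the set of active edges in round $i$. Consider any arbitrary state of the protocol in round $i$. Then $$\mathbb{E}\big[|{\cal E}_{i+3}|\big] \le \tfrac{6}{7}\,|{\cal E}_i| + \tfrac{8}{7}\,|A_{i+3}\cup A_{i+2}\cup A_{i+1}|,$$ where the expectation is over the random $\ell$-values chosen in rounds $i$ and later.
   Context: Agents are the vertices of an undirected communication graph; agents know nothing about the graph. Each agent is in one of three states $\{\textsc{Out},\textsc{In},\textsc{Un}\}$ and operates in synchronous rounds (all rounds start and end simultaneously; every note sung in a round is heard by all neighbors by the end of the round). Self-jamming communication: an agent hears the union of notes sung by its neighbors except the notes it sings itself (presence only, not multiplicity). Self-jamming singing protocol (one round, agent in state $s$): compute a fresh $\ell$-value by flipping a fair coin until the first $0$, $\ell$ = number of flips (independent across agents and rounds). If $s=\textsc{Out}$: sing nothing, listen for note $0$. If $s=\textsc{In}$: sing even notes $0,2,\dots,2\ell-2$, listen for note $2\ell$. If $s=\textsc{Un}$: sing odd notes $1,3,\dots,2\ell-1$, listen for notes $0$ and $2\ell+1$. End of round: $\textsc{In}$ becomes $\textsc{Un}$ if it heard note $2\ell$, else stays $\textsc{In}$; $\textsc{Un}$ becomes $\textsc{Out}$ if it heard $0$, otherwise stays $\textsc{Un}$ if it heard $2\ell+1$ and becomes $\textsc{In}$ if not; $\textsc{Out}$ stays $\textsc{Out}$ if it heard $0$, else becomes $\textsc{Un}$. Dynamic networks: agents and edges may be inserted or deleted; all such changes are regarded as occurring at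 the beginning of a round; new agents start in arbitrary states. An agent that changes state arbitrarily or does not execute the protocol correctly at the end of round $i-1$ is modeled as being deleted and reinserted (with its edges) in its new state at the beginning of round $i$. An agent is changed in round $i$ if it is incident to an edge added or deleted at the beginning of round $i$. An edge is affected in round $i$ if one of its endpoints is at distance at most $2$ from an agent changed in round $i$; $A_i$ is the set of edges affected in round $i$. An agent is $\textsc{In}^{\overline{\textsc{In}}}$ in a round if it is $\textsc{In}$ and has no $\textsc{In}$ neighbor in that round. An agent is eliminated in round $i$ if it is $\textsc{In}^{\overline{\textsc{In}}}$ or adjacent to an $\textsc{In}^{\overline{\textsc{In}}}$ agent in round $i$; otherwise active. An edge is eliminated if some endpoint is eliminated, otherwise active. -}

module Defs where

open import Data.Bool using (Bool; true; false; _∧_; _∨_; not; if_then_else_; _xor_)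
open import Data.Nat as ℕ using (ℕ; zero; suc; _<ᵇ_; _≡ᵇ_)
open import Data.Fin using (Fin; toℕ)
open import Data.List as List using (List; []; _∷_; map; concatMap; foldr; upTo; allFin)
open import Data.Bool.ListAction using (any)
open import Data.Nat.ListAction using (sum)
open import Data.Maybe using (Maybe; just; nothing; is-just)
open import Data.Integer using (+_)
open import Data.Rational using (ℚ; _/_; _*_; _+_; 0ℚ; 1ℚ; ½)
open import Data.Vec.Functional using (Vector) renaming (_∷_ to _∷ᶠ_)
open import Relation.Binary.PropositionalEquality using (_≡_)

data St : Set where
  Out In Un : St

isIn : St → Bool
isIn In = true
isIn _  = false

-- Simple undirected graphs on the agent universe Fin n
-- (agents not currently in the network are isolated vertices)

record Graph (n : ℕ) : Set where
  field
    adj    : Fin n → Fin n → Bool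
    sym    : ∀ u v → adj u v ≡ adj v u
    irrefl : ∀ v → adj v v ≡ false
open Graph public

anyAgent : {n : ℕ} → (Fin n → Bool) → Bool
anyAgent {n} p = any p (allFin n)

countPairs : {n : ℕ} → (Fin n → Fin n → Bool) → ℕ
countPairs {n} P =
  sum (map (λ u → sum (map (λ v →
     if (toℕ u <ᵇ toℕ v) ∧ P u v then 1 else 0) (allFin n))) (allFin n))

isEven : ℕ → Bool
isEven zero = true
isEven (suc zero) = false
isEven (suc (suc k)) = isEven k

sings : St → ℕ → ℕ → Bool
sings Out ℓ k = false
sings In  ℓ k = isEven k ∧ (k <ᵇ 2 ℕ.* ℓ)
sings Un  ℓ k = not (isEven k) ∧ (k <ᵇ 2 ℕ.* ℓ)

hears : {n : ℕ} → Graph n → (Fin n → St) → (Fin n → ℕ) → Fin n → ℕ → Bool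
hears G s ℓ v k =
  not (sings (s v) (ℓ v) k) ∧ anyAgent (λ u → adj G v u ∧ sings (s u) (ℓ u) k)

step : {n : ℕ} → Graph n → (Fin n → St) → (Fin n → ℕ) → Fin n → St
step G s ℓ v with s v
... | In  = if hears G s ℓ v (2 ℕ.* ℓ v) then Un else In
... | Un  = if hears G s ℓ v 0 then Out
            else (if hears G s ℓ v (suc (2 ℕ.* ℓ v)) then Un else In)
... | Out = if hears G s ℓ v 0 then Out else Un

-- arbitrary state (re)assignment by the adversary at the beginning of a round
override : {n : ℕ} → (Fin n → Maybe St) → (Fin n → St) → Fin n → St
override o s v with o v
... | just t  = t
... | nothing = s v

InNoIn : {n : ℕ} → Graph n → (Fin n → St) → Fin n → Bool
InNoIn G s v = isIn (s v) ∧ not (anyAgent (λ u → adj G v u ∧ isIn (s u)))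

eliminated : {n : ℕ} → Graph n → (Fin n → St) → Fin n → Bool
eliminated G s v = InNoIn G s v ∨ anyAgent (λ u → adj G v u ∧ InNoIn G s u)

active : {n : ℕ} → Graph n → (Fin n → St) → Fin n → Bool
active G s v = not (eliminated G s v)

activeEdges : {n : ℕ} → Graph n → (Fin n → St) → ℕ
activeEdges G s = countPairs (λ u v → adj G u v ∧ active G s u ∧ active G s v)

changed : {n : ℕ} → Graph n → Graph n → (Fin n → Maybe St) → Fin n → Bool
changed Gp Gn o v = is-just (o v) ∨ anyAgent (λ u → adj Gp v u xor adj Gn v u)

nearChanged : {n : ℕ} → Graph n → Graph n → (Fin n → Maybe St) → Fin n → Bool
nearChanged Gp Gn o v =
  changed Gp Gn o v ∨
  anyAgent (λ u → adj Gn v u ∧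
    (changed Gp Gn o u ∨ anyAgent (λ w → adj Gn u w ∧ changed Gp Gn o w)))

affected : {n : ℕ} → Graph n → Graph n → (Fin n → Maybe St) → Fin n → Fin n → Bool
affected Gp Gn o u v = adj Gn u v ∧ (nearChanged Gp Gn o u ∨ nearChanged Gp Gn o v)

-- Randomness: ℓ-values, geometric with P(ℓ = k) = 2^{-k}, k ≥ 1.

ℕtoℚ : ℕ → ℚ
ℕtoℚ k = + k / 1

sumℚ : List ℚ → ℚ
sumℚ = foldr _+_ 0ℚ

½^ : ℕ → ℚ
½^ zero = 1ℚ
½^ (suc k) = ½ * ½^ k

allAssign : (n : ℕ) → List ℕ → List (Fin n → ℕ)
allAssign zero xs = (λ ()) ∷ []
allAssign (suc n) xs = concatMap (λ x → map (λ f → x ∷ᶠ f) (allAssign n xs)) xs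

-- probability of one round's ℓ-assignment (independent across agents)
weight : {n : ℕ} → (Fin n → ℕ) → ℚ
weight {n} ℓ = foldr (λ v q → ½^ (ℓ v) * q) 1ℚ (allFin n)

range : ℕ → List ℕ
range N = map suc (upTo N)

-- Truncated expectation Σ_{ℓ ∈ {1..N}^{3n}} P(ℓ) · X(ℓ) of a nonnegative
-- function X of the ℓ-values of three consecutive rounds.  Since X ≥ 0, the
-- (true) expectation is the supremum over N of these truncated sums.
truncExp3 : {n : ℕ} → ℕ → ((Fin n → ℕ) → (Fin n → ℕ) → (Fin n → ℕ) → ℕ) → ℚ
truncExp3 {n} N X =
  sumℚ (map (λ ℓ₀ → sumℚ (map (λ ℓ₁ → sumℚ (map (λ ℓ₂ →
     weight ℓ₀ * weight ℓ₁ * weight ℓ₂ * ℕtoℚ (X ℓ₀ ℓ₁ ℓ₂))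
       (allAssign n (range N)))) (allAssign n (range N)))) (allAssign n (range N)))

-- The execution over rounds i, i+1, i+2, i+3.
-- G₀ s₀ : network and states in round i.
-- (Gⱼ , oⱼ) : network of round i+j and adversarial state (re)assignments at
-- the beginning of round i+j, j = 1,2,3 (oblivious adversary).

state3 : {n : ℕ} → Graph n → (Fin n → St) →
         Graph n → (Fin n → Maybe St) → Graph n → (Fin n → Maybe St) →
         Graph n → (Fin n → Maybe St) →
         (Fin n → ℕ) → (Fin n → ℕ) → (Fin n → ℕ) → Fin n → St
state3 G₀ s₀ G₁ o₁ G₂ o₂ G₃ o₃ ℓ₀ ℓ₁ ℓ₂ =
  let s₁ = override o₁ (step G₀ s₀ ℓ₀)
      s₂ = override o₂ (step G₁ s₁ ℓ₁)
  in  override o₃ (step G₂ s₂ ℓ₂)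

affectedUnion : {n : ℕ} → Graph n → Graph n → (Fin n → Maybe St) → Graph n → (Fin n → Maybe St) →
                Graph n → (Fin n → Maybe St) → ℕ
affectedUnion G₀ G₁ o₁ G₂ o₂ G₃ o₃ =
  countPairs (λ u v → affected G₀ G₁ o₁ u v ∨ affected G₁ G₂ o₂ u v ∨ affected G₂ G₃ o₃ u v)

{-# OPTIONS --safe #-}
-- An agent in state In after a round has beaten its rivals weakly; raising its ℓ-value by one would have made it an
-- In agent without In neighbours, so (ℓ being geometric) whenever some agent of N[u] ∪ N[v] is In after a round, the
-- edge uv is eliminated by that round with conditional probability at least 1/2. An edge whose surroundings stay free
-- of In agents after rounds i and i+1 has both ends Un and without In neighbours in round i+2. Such edges lose a
-- constant fraction in that round by the argument of Métivier et al.: for an edge uv, with probability at least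
-- (2/5)/(d(u)+d(v)), v has the strictly largest ℓ-value among the Un neighbours of u and v, and then eliminates all
-- edges at u; these events are disjoint for fixed u, and each edge is charged at most twice.
-- Far from all changes the static dynamics apply verbatim, and edges at u eliminated in the last step that are
-- not far from a change are affected edges, whose elimination may be counted as well.
--
-- Truncation is dealt with by replacing ℓ with min(ℓ, L+1) for some L ≥ N, a law of total mass 1, and counting every
-- edge as eliminated as soon as some ℓ-value reaches the cap: there, raising the value is impossible.
module Submission where

open import Defs renaming (sym to adj-sym; irrefl to adj-irrefl)
open import Algebra.Bundles using (CommutativeRing)
open import Data.Bool using (Bool; true; false; T; _∧_; _∨_; not; if_then_else_; _xor_)
open import Data.Bool.ListAction using (any)
open import Data.Bool.Properties using (T-∧; T-∨; T-≡; T-not-≡; ∧-comm; ∨-comm)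
open import Data.Empty using (⊥; ⊥-elim)
open import Data.Fin using (Fin; zero; suc; toℕ; _≟_)
open import Data.Fin.Properties using (0≢1+n; suc-injective; toℕ<n; toℕ-injective)
import Data.Integer as ℤ
import Data.Integer.Properties as ℤ
open import Data.List using (List; []; _∷_; _++_; map; concatMap; foldr; tabulate; applyUpTo; allFin)
open import Data.List.Membership.Propositional using (_∈_; lose; find)
open import Data.List.Membership.Propositional.Properties using (∈-allFin)
open import Data.List.Properties using (map-++; map-∘; map-applyUpTo; map-cong)
open import Data.List.Relation.Unary.Any.Properties using (any⁺; any⁻)
open import Data.Maybe using (Maybe; just; nothing; is-just)
open import Data.Nat as ℕ using (ℕ; zero; suc; z≤n; s≤s)
open import Data.Nat.Coprimality as Coprime using (Coprime; 1-coprimeTo)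
open import Data.Nat.ListAction using () renaming (sum to sumℕ)
import Data.Nat.Properties as ℕ
open import Data.Product using (_×_; _,_; proj₁; proj₂; ∃)
open import Data.Rational using (ℚ; 0ℚ; 1ℚ; ½; _+_; _*_; -_; _/_; _≤_; nonNegative)
open import Data.Rational.Properties hiding (_≟_)
open import Data.Rational.Solver using (module +-*-Solver)
open import Data.Sum using (_⊎_; inj₁; inj₂; [_,_]′)
open import Data.Unit using (tt)
import Data.Vec.Functional as Vector
open Vector using () renaming (_∷_ to _∷ᶠ_)
open import Algebra.Properties.Semiring.Exp (CommutativeRing.semiring +-*-commutativeRing)
  using (_^_; ^-homo-*)
open import Algebra.Properties.Semiring.Sum (CommutativeRing.semiring +-*-commutativeRing)
  using (sum; ∑-distrib-+; ∑-comm; *-distribˡ-sum; sum-cong-≗)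
open import Function using (_∘_; id)
open import Function.Bundles using (Equivalence)
open import Relation.Binary using (tri<; tri≈; tri>)
open import Relation.Binary.PropositionalEquality as ≡ using (_≡_; _≢_; refl; cong; cong₂; subst)
open import Relation.Nullary using (¬_; yes; no)
open import Relation.Nullary.Decidable using (⌊_⌋; toWitness; fromWitness; T?; decidable-stable)
open +-*-Solver using (solve; _:=_; _:+_; _:*_; :-_; con)

private
  variable
    n : ℕ

-- Indicators, rational inequalities and finite sums

⟦_⟧ : Bool → ℚ
⟦ true ⟧ = 1ℚ
⟦ false ⟧ = 0ℚ

0≤1 : 0ℚ ≤ 1ℚ
0≤1 = nonNegative⁻¹ 1ℚ

0≤⟦_⟧ : ∀ b → 0ℚ ≤ ⟦ b ⟧
0≤⟦ true ⟧  = 0≤1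
0≤⟦ false ⟧ = ≤-refl

⟦⟧≤1 : ∀ b → ⟦ b ⟧ ≤ 1ℚ
⟦⟧≤1 true  = ≤-refl
⟦⟧≤1 false = 0≤1

⟦⟧-mono : ∀ {a b} → (T a → T b) → ⟦ a ⟧ ≤ ⟦ b ⟧
⟦⟧-mono {false} {b}     _   = 0≤⟦ b ⟧
⟦⟧-mono {true}  {true}  _   = ≤-refl
⟦⟧-mono {true}  {false} a⇒b = ⊥-elim (a⇒b tt)

⟦⟧-∧ : ∀ a b → ⟦ a ∧ b ⟧ ≡ ⟦ a ⟧ * ⟦ b ⟧
⟦⟧-∧ true  b = ≡.sym (*-identityˡ ⟦ b ⟧)
⟦⟧-∧ false b = ≡.sym (*-zeroˡ ⟦ b ⟧)

*-monoˡ-≤ : ∀ {p q r} → 0ℚ ≤ r → p ≤ q → r * p ≤ r * q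
*-monoˡ-≤ {r = r} 0≤r = *-monoˡ-≤-nonNeg r {{nonNegative 0≤r}}

*-mono-≤ : ∀ {p q r s} → 0ℚ ≤ q → 0ℚ ≤ r → p ≤ q → r ≤ s → p * r ≤ q * s
*-mono-≤ {p} {q} {r} {s} 0≤q 0≤r p≤q r≤s =
  ≤-trans (*-monoʳ-≤-nonNeg r {{nonNegative 0≤r}} p≤q) (*-monoˡ-≤ 0≤q r≤s)

0≤+ : ∀ {p q} → 0ℚ ≤ p → 0ℚ ≤ q → 0ℚ ≤ p + q
0≤+ = +-mono-≤

0≤* : ∀ {p q} → 0ℚ ≤ p → 0ℚ ≤ q → 0ℚ ≤ p * q
0≤* {p} {q} 0≤p 0≤q = subst (_≤ p * q) (*-zeroʳ p) (*-monoˡ-≤ 0≤p 0≤q)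

p≤p+q : ∀ {p q} → 0ℚ ≤ q → p ≤ p + q
p≤p+q {p} {q} 0≤q = subst (_≤ p + q) (+-identityʳ p) (+-monoʳ-≤ p 0≤q)

0≤½ : 0ℚ ≤ ½
0≤½ = nonNegative⁻¹ ½

2ℚ : ℚ
2ℚ = 1ℚ + 1ℚ

sum-mono : {f g : Fin n → ℚ} → (∀ i → f i ≤ g i) → sum f ≤ sum g
sum-mono {zero}  f≤g = ≤-refl
sum-mono {suc n} f≤g = +-mono-≤ (f≤g zero) (sum-mono (f≤g ∘ suc))

0≤sum : {f : Fin n → ℚ} → (∀ i → 0ℚ ≤ f i) → 0ℚ ≤ sum f
0≤sum {zero}  0≤f = ≤-refl
0≤sum {suc n} 0≤f = 0≤+ (0≤f zero) (0≤sum (0≤f ∘ suc))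

sum-false : {p : Fin n → Bool} → (∀ i → T (p i) → ⊥) → sum (λ i → ⟦ p i ⟧) ≤ 0ℚ
sum-false {zero}      ¬p = ≤-refl
sum-false {suc n} {p} ¬p = +-mono-≤ {y = 0ℚ} {v = 0ℚ} (⟦⟧-mono {p zero} {false} (¬p zero)) (sum-false (¬p ∘ suc))

-- Disjoint events inside one event `b`. It turns the uniqueness of a winner, or of a winning value,
-- into an inequality between sums of probabilities.
sum-unique : {p : Fin n → Bool} {b : Bool} → (∀ i → T (p i) → T b) →
             (∀ i j → T (p i) → T (p j) → i ≡ j) → sum (λ i → ⟦ p i ⟧) ≤ ⟦ b ⟧
sum-unique {zero}  {p} {b} p⇒b uniq = 0≤⟦ b ⟧
sum-unique {suc n} {p} {b} p⇒b uniq with p zero in eq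
... | false = subst (_≤ ⟦ b ⟧) (≡.sym (+-identityˡ _))
                (sum-unique (p⇒b ∘ suc) λ i j pᵢ pⱼ → suc-injective (uniq (suc i) (suc j) pᵢ pⱼ))
... | true = ≤-trans (+-monoʳ-≤ 1ℚ (sum-false λ i pᵢ → 0≢1+n (uniq zero (suc i) (Equivalence.from T-≡ eq) pᵢ)))
               (⟦⟧-mono {true} {b} λ _ → p⇒b zero (Equivalence.from T-≡ eq))

-- The capped geometric law

-- Expectation of f (min(ℓ, L+1)) for ℓ geometric on {1, 2, …}: flip one coin, and restart with cap L on a 1.
μ : ℕ → (ℕ → ℚ) → ℚ
μ zero    f = f 1
μ (suc L) f = ½ * f 1 + ½ * μ L (f ∘ suc)

½+½ : ∀ p → ½ * p + ½ * p ≡ p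
½+½ p = ≡.trans (≡.sym (*-distribʳ-+ p ½ ½)) (*-identityˡ p)

-- `μ` evaluates its argument at positive numbers only, so the comparison is asked for there only.
-- Across all agents this becomes the side condition `Pos`.
μ-mono : ∀ L {f g} → (∀ k → f (suc k) ≤ g (suc k)) → μ L f ≤ μ L g
μ-mono zero    f≤g = f≤g 0
μ-mono (suc L) f≤g = +-mono-≤ (*-monoˡ-≤ 0≤½ (f≤g 0)) (*-monoˡ-≤ 0≤½ (μ-mono L (f≤g ∘ suc)))

μ-+ : ∀ L f g → μ L (λ k → f k + g k) ≡ μ L f + μ L g
μ-+ zero    f g = refl
μ-+ (suc L) f g rewrite μ-+ L (f ∘ suc) (g ∘ suc) =
  solve 5 (λ h a b c d → h :* (a :+ b) :+ h :* (c :+ d) := (h :* a :+ h :* c) :+ (h :* b :+ h :* d))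
    refl ½ (f 1) (g 1) (μ L (f ∘ suc)) (μ L (g ∘ suc))

μ-* : ∀ L c f → μ L (λ k → c * f k) ≡ c * μ L f
μ-* zero    c f = refl
μ-* (suc L) c f rewrite μ-* L c (f ∘ suc) =
  solve 4 (λ h c a b → h :* (c :* a) :+ h :* (c :* b) := c :* (h :* a :+ h :* b))
    refl ½ c (f 1) (μ L (f ∘ suc))

μ-const : ∀ L c → μ L (λ _ → c) ≡ c
μ-const zero    c = refl
μ-const (suc L) c rewrite μ-const L c = ½+½ c

μ-cong : ∀ L {f g} → (∀ k → f k ≡ g k) → μ L f ≡ μ L g
μ-cong zero    f≡g = f≡g 1
μ-cong (suc L) f≡g = cong₂ (λ a b → ½ * a + ½ * b) (f≡g 1) (μ-cong L (f≡g ∘ suc))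

0≤μ : ∀ L {f} → (∀ k → 0ℚ ≤ f (suc k)) → 0ℚ ≤ μ L f
0≤μ L {f} 0≤f = subst (_≤ μ L f) (μ-const L 0ℚ) (μ-mono L 0≤f)

-- Raising the value by one halves the mass; the extra h 1 makes the induction go through.
μ-shift : ∀ L {g h} → (∀ k → g (suc k) ≤ h (suc (suc k))) → g (suc L) ≤ h (suc L) →
          h 1 + μ L g ≤ 2ℚ * μ L h
μ-shift zero {g} {h} _ top =
  ≤-trans (+-monoʳ-≤ (h 1) top) (≤-reflexive (solve 1 (λ a → a :+ a := con 2ℚ :* a) refl (h 1)))
μ-shift (suc L) {g} {h} g≤h top = begin
  h 1 + (½ * g 1 + ½ * μ L (g ∘ suc))           ≡⟨ cong (h 1 +_) (≡.sym (*-distribˡ-+ ½ (g 1) (μ L (g ∘ suc)))) ⟩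
  h 1 + ½ * (g 1 + μ L (g ∘ suc))               ≤⟨ +-monoʳ-≤ (h 1) (*-monoˡ-≤ 0≤½ (+-monoˡ-≤ _ (g≤h 0))) ⟩
  -- For the shifted functions `h 2` takes the place of `h 1`; the previous step supplied exactly
  -- this extra term out of `g 1`.
  h 1 + ½ * (h 2 + μ L (g ∘ suc))               ≤⟨ +-monoʳ-≤ (h 1) (*-monoˡ-≤ 0≤½ (μ-shift L {g ∘ suc} {h ∘ suc} (g≤h ∘ suc) top)) ⟩
  h 1 + ½ * (2ℚ * μ L (h ∘ suc))                ≡⟨ solve 2 (λ a b → a :+ con ½ :* (con 2ℚ :* b) := con 2ℚ :* (con ½ :* a :+ con ½ :* b)) refl (h 1) (μ L (h ∘ suc)) ⟩
  2ℚ * (½ * h 1 + ½ * μ L (h ∘ suc))            ∎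
  where open ≤-Reasoning

-- The product law on assignments

Pos : (Fin n → ℕ) → Set
Pos ℓ = ∀ v → 1 ℕ.≤ ℓ v

𝔼 : ℕ → ((Fin n → ℕ) → ℚ) → ℚ
-- The only element of allAssign 0 [] is the empty assignment of truncExp3, which is not definitionally any other λ ().
𝔼 {zero}  L f = foldr (λ ℓ _ → f ℓ) 0ℚ (allAssign 0 [])
𝔼 {suc n} L f = μ L (λ x → 𝔼 L (λ ℓ → f (x ∷ᶠ ℓ)))

𝔼-mono : ∀ L {f g : (Fin n → ℕ) → ℚ} → (∀ ℓ → Pos ℓ → f ℓ ≤ g ℓ) → 𝔼 L f ≤ 𝔼 L g
𝔼-mono {zero}  L f≤g = f≤g _ λ ()
𝔼-mono {suc n} L f≤g = μ-mono L λ x → 𝔼-mono L λ ℓ pos → f≤g (suc x ∷ᶠ ℓ) λ { zero → s≤s z≤n ; (suc v) → pos v }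

𝔼-cong : ∀ L {f g : (Fin n → ℕ) → ℚ} → (∀ ℓ → f ℓ ≡ g ℓ) → 𝔼 L f ≡ 𝔼 L g
𝔼-cong {zero}  L f≡g = f≡g _
𝔼-cong {suc n} L f≡g = μ-cong L λ x → 𝔼-cong L λ ℓ → f≡g (x ∷ᶠ ℓ)

𝔼-+ : ∀ L (f g : (Fin n → ℕ) → ℚ) → 𝔼 L (λ ℓ → f ℓ + g ℓ) ≡ 𝔼 L f + 𝔼 L g
𝔼-+ {zero}  L f g = refl
𝔼-+ {suc n} L f g = ≡.trans (μ-cong L λ x → 𝔼-+ L (f ∘ (x ∷ᶠ_)) (g ∘ (x ∷ᶠ_))) (μ-+ L _ _)

𝔼-* : ∀ L c (f : (Fin n → ℕ) → ℚ) → 𝔼 L (λ ℓ → c * f ℓ) ≡ c * 𝔼 L f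
𝔼-* {zero}  L c f = refl
𝔼-* {suc n} L c f = ≡.trans (μ-cong L λ x → 𝔼-* L c (f ∘ (x ∷ᶠ_))) (μ-* L c _)

𝔼-const : ∀ L c → 𝔼 {n} L (λ _ → c) ≡ c
𝔼-const {zero}  L c = refl
𝔼-const {suc n} L c = ≡.trans (μ-cong L λ x → 𝔼-const {n} L c) (μ-const L c)

𝔼-sum : ∀ L {m} (f : Fin m → (Fin n → ℕ) → ℚ) → 𝔼 L (λ ℓ → sum (λ i → f i ℓ)) ≡ sum (λ i → 𝔼 L (f i))
𝔼-sum {n} L {zero}  f = 𝔼-const {n} L 0ℚ
𝔼-sum {n} L {suc m} f = ≡.trans (𝔼-+ L (f zero) (λ ℓ → sum (λ i → f (suc i) ℓ))) (cong (𝔼 L (f zero) +_) (𝔼-sum L (f ∘ suc)))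

0≤𝔼 : ∀ L {f : (Fin n → ℕ) → ℚ} → (∀ ℓ → Pos ℓ → 0ℚ ≤ f ℓ) → 0ℚ ≤ 𝔼 L f
0≤𝔼 {n} L {f} 0≤f = subst (_≤ 𝔼 L f) (𝔼-const {n} L 0ℚ) (𝔼-mono L 0≤f)

infixl 9 _[_≔_]
-- Recursion on the index, rather than a test for equality, makes updating commute with `∷ᶠ`
-- definitionally, as `𝔼-coordinate` requires.
_[_≔_] : (Fin n → ℕ) → Fin n → ℕ → Fin n → ℕ
_[_≔_] {suc n} ℓ zero    k = k ∷ᶠ (ℓ ∘ suc)
_[_≔_] {suc n} ℓ (suc v) k = ℓ zero ∷ᶠ ((ℓ ∘ suc) [ v ≔ k ])

[≔]-same : ∀ (ℓ : Fin n → ℕ) v k → (ℓ [ v ≔ k ]) v ≡ k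
[≔]-same ℓ zero    k = refl
[≔]-same ℓ (suc v) k = [≔]-same (ℓ ∘ suc) v k

[≔]-other : ∀ (ℓ : Fin n → ℕ) v k u → u ≢ v → (ℓ [ v ≔ k ]) u ≡ ℓ u
[≔]-other ℓ zero    k zero    u≢v = ⊥-elim (u≢v refl)
[≔]-other ℓ zero    k (suc u) u≢v = refl
[≔]-other ℓ (suc v) k zero    u≢v = refl
[≔]-other ℓ (suc v) k (suc u) u≢v = [≔]-other (ℓ ∘ suc) v k u (u≢v ∘ cong suc)

-- Fubini: average over the value at `v` first, with all other values frozen. It then suffices to
-- compare the two functions along a single coordinate.
𝔼-coordinate : ∀ L (v : Fin n) {f g : (Fin n → ℕ) → ℚ} →
                (∀ ℓ → Pos ℓ → μ L (λ k → f (ℓ [ v ≔ k ])) ≤ μ L (λ k → g (ℓ [ v ≔ k ]))) → 𝔼 L f ≤ 𝔼 L g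
𝔼-coordinate {suc n} L zero {f} {g} f≤g = begin
  𝔼 L f                                        ≡⟨ swap f ⟩
  -- The value 1 is a dummy that the update overwrites; it is positive so that `Pos` holds.
  𝔼 L (λ ℓ → μ L (λ k → f (k ∷ᶠ ℓ)))           ≤⟨ 𝔼-mono L (λ ℓ pos → f≤g (1 ∷ᶠ ℓ) λ { zero → s≤s z≤n ; (suc v) → pos v }) ⟩
  𝔼 L (λ ℓ → μ L (λ k → g (k ∷ᶠ ℓ)))           ≡⟨ swap g ⟨
  𝔼 L g                                        ∎
  where
  open ≤-Reasoning
  -- The cap `K` of the outer law is separated from `L`, so that the induction on `K` leaves the
  -- inner expectation untouched.
  μ-𝔼 : ∀ K (h : ℕ → (Fin n → ℕ) → ℚ) → μ K (λ x → 𝔼 L (h x)) ≡ 𝔼 L (λ ℓ → μ K (λ x → h x ℓ))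
  μ-𝔼 zero    h = refl
  μ-𝔼 (suc K) h = ≡.trans
    (cong₂ _+_ (≡.sym (𝔼-* L ½ (h 1))) (≡.trans (cong (½ *_) (μ-𝔼 K (h ∘ suc))) (≡.sym (𝔼-* L ½ (λ ℓ → μ K (λ x → h (suc x) ℓ))))))
    (≡.sym (𝔼-+ L (λ ℓ → ½ * h 1 ℓ) (λ ℓ → ½ * μ K (λ x → h (suc x) ℓ))))
  swap : ∀ (h : (Fin (suc n) → ℕ) → ℚ) → 𝔼 L h ≡ 𝔼 L (λ ℓ → μ L (λ k → h (k ∷ᶠ ℓ)))
  swap h = μ-𝔼 L (λ x ℓ → h (x ∷ᶠ ℓ))
𝔼-coordinate {suc n} L (suc v) f≤g = μ-mono L λ x → 𝔼-coordinate L v λ ℓ pos →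
  f≤g (suc x ∷ᶠ ℓ) λ { zero → s≤s z≤n ; (suc v) → pos v }

-- Independent events and products

conj : (Fin n → Bool) → Bool
conj = Vector.foldr _∧_ true

prod : (Fin n → ℚ) → ℚ
prod = Vector.foldr _*_ 1ℚ

conj⁻ : (b : Fin n → Bool) → T (conj b) → ∀ v → T (b v)
conj⁻ b h zero    = proj₁ (Equivalence.to (T-∧ {b zero}) h)
conj⁻ b h (suc v) = conj⁻ (b ∘ suc) (proj₂ (Equivalence.to (T-∧ {b zero}) h)) v

conj⁺ : (b : Fin n → Bool) → (∀ v → T (b v)) → T (conj b)
conj⁺ {zero}  b h = tt
conj⁺ {suc n} b h = Equivalence.from T-∧ (h zero , conj⁺ (b ∘ suc) (h ∘ suc))

𝔼-independent : ∀ L (b : Fin n → ℕ → Bool) →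
                 𝔼 L (λ ℓ → ⟦ conj (λ v → b v (ℓ v)) ⟧) ≡ prod (λ v → μ L (λ k → ⟦ b v k ⟧))
𝔼-independent {zero}  L b = refl
𝔼-independent {suc n} L b = begin
  μ L (λ x → 𝔼 L (λ ℓ → ⟦ b zero x ∧ rest ℓ ⟧))              ≡⟨ μ-cong L (λ x → 𝔼-cong L (λ ℓ → ⟦⟧-∧ (b zero x) (rest ℓ))) ⟩
  μ L (λ x → 𝔼 L (λ ℓ → ⟦ b zero x ⟧ * ⟦ rest ℓ ⟧))          ≡⟨ μ-cong L (λ x → ≡.trans (𝔼-* L ⟦ b zero x ⟧ (λ ℓ → ⟦ rest ℓ ⟧)) (*-comm ⟦ b zero x ⟧ P)) ⟩
  μ L (λ x → P * ⟦ b zero x ⟧)                                ≡⟨ μ-* L P (λ x → ⟦ b zero x ⟧) ⟩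
  P * μ L (λ x → ⟦ b zero x ⟧)                                ≡⟨ *-comm P _ ⟩
  μ L (λ x → ⟦ b zero x ⟧) * P                                ≡⟨ cong (μ L (λ x → ⟦ b zero x ⟧) *_) (𝔼-independent L (b ∘ suc)) ⟩
  prod (λ v → μ L (λ k → ⟦ b v k ⟧))                          ∎
  where
  open ≡.≡-Reasoning
  rest : (Fin n → ℕ) → Bool
  rest ℓ = conj (λ v → b (suc v) (ℓ v))
  P : ℚ
  P = 𝔼 L (λ ℓ → ⟦ rest ℓ ⟧)

0≤^ : ∀ {a} m → 0ℚ ≤ a → 0ℚ ≤ a ^ m
0≤^ zero    0≤a = 0≤1
0≤^ (suc m) 0≤a = 0≤* 0≤a (0≤^ m 0≤a)

total : (Fin n → ℕ) → ℕ
total = Vector.foldr ℕ._+_ 0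

totalExcept : Fin n → (Fin n → ℕ) → ℕ
totalExcept zero    e = total (e ∘ suc)
totalExcept (suc v) e = e zero ℕ.+ totalExcept v (e ∘ suc)

total-split : ∀ (v : Fin n) e → total e ≡ e v ℕ.+ totalExcept v e
total-split zero    e = refl
total-split (suc v) e rewrite total-split v (e ∘ suc) = x∙yz≈y∙xz (e zero) (e (suc v)) _
  where open import Algebra.Properties.CommutativeSemigroup ℕ.+-commutativeSemigroup using (x∙yz≈y∙xz)

total-+ : ∀ (e f : Fin n → ℕ) → total (λ v → e v ℕ.+ f v) ≡ total e ℕ.+ total f
total-+ {zero}  e f = refl
total-+ {suc n} e f rewrite total-+ (e ∘ suc) (f ∘ suc) = interchange (e zero) (f zero) _ _
  where open import Algebra.Properties.CommutativeSemigroup ℕ.+-commutativeSemigroup using (interchange)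

prod-≥^ : ∀ {a} → 0ℚ ≤ a → (c : Fin n → ℚ) (e : Fin n → ℕ) → (∀ v → a ^ e v ≤ c v) → a ^ total e ≤ prod c
prod-≥^ {zero}  0≤a c e h = ≤-refl
prod-≥^ {suc n} {a} 0≤a c e h = begin
  a ^ (e zero ℕ.+ total (e ∘ suc))       ≡⟨ ^-homo-* a (e zero) (total (e ∘ suc)) ⟩
  a ^ e zero * a ^ total (e ∘ suc)       ≤⟨ *-mono-≤ (≤-trans (0≤^ (e zero) 0≤a) (h zero)) (0≤^ (total (e ∘ suc)) 0≤a) (h zero) (prod-≥^ 0≤a (c ∘ suc) (e ∘ suc) (h ∘ suc)) ⟩
  prod c                                 ∎
  where open ≤-Reasoning

-- The form needed when `v` takes an exact value and its rivals stay below it: one factor `p` for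
-- `v`, while the exponents of all other agents collect into a single power.
prod-≥ : ∀ {a p} → 0ℚ ≤ a → 0ℚ ≤ p → (v : Fin n) (c : Fin n → ℚ) (e : Fin n → ℕ) →
         p ≤ c v → (∀ u → u ≢ v → a ^ e u ≤ c u) → p * a ^ totalExcept v e ≤ prod c
prod-≥ 0≤a 0≤p zero c e p≤ h =
  *-mono-≤ (≤-trans 0≤p p≤) (0≤^ (total (e ∘ suc)) 0≤a) p≤ (prod-≥^ 0≤a (c ∘ suc) (e ∘ suc) (λ u → h (suc u) λ ()))
prod-≥ {a = a} {p} 0≤a 0≤p (suc v) c e p≤ h = begin
  p * a ^ (e zero ℕ.+ m)       ≡⟨ cong (p *_) (^-homo-* a (e zero) m) ⟩
  p * (a ^ e zero * a ^ m)     ≡⟨ solve 3 (λ x y z → x :* (y :* z) := y :* (x :* z)) refl p (a ^ e zero) (a ^ m) ⟩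
  a ^ e zero * (p * a ^ m)     ≤⟨ *-mono-≤ (≤-trans (0≤^ (e zero) 0≤a) (h zero λ ())) (0≤* 0≤p (0≤^ m 0≤a)) (h zero λ ())
                                     (prod-≥ 0≤a 0≤p v (c ∘ suc) (e ∘ suc) p≤ (λ u u≢v → h (suc u) (λ { refl → u≢v refl }))) ⟩
  prod c                       ∎
  where
  open ≤-Reasoning
  m = totalExcept v (e ∘ suc)

-- The probability of a strict maximum

0≤½^ : ∀ k → 0ℚ ≤ ½^ k
0≤½^ zero    = 0≤1
0≤½^ (suc k) = 0≤* 0≤½ (0≤½^ k)

-- cdf k = 1 − 2⁻ᵏ is the probability of a value at most k.
cdf : ℕ → ℚ
cdf zero    = 0ℚ
cdf (suc k) = ½ * 1ℚ + ½ * cdf k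

0≤cdf : ∀ k → 0ℚ ≤ cdf k
0≤cdf zero    = ≤-refl
0≤cdf (suc k) = 0≤+ (0≤* 0≤½ 0≤1) (0≤* 0≤½ (0≤cdf k))

cdf+½^ : ∀ k → cdf k + ½^ k ≡ 1ℚ
cdf+½^ zero    = refl
cdf+½^ (suc k) = ≡.trans
  (solve 2 (λ c h → (con ½ :* con 1ℚ :+ con ½ :* c) :+ con ½ :* h := con ½ :* con 1ℚ :+ con ½ :* (c :+ h)) refl (cdf k) (½^ k))
  (≡.trans (cong (λ p → ½ * 1ℚ + ½ * p) (cdf+½^ k)) refl)

cdf≤1 : ∀ k → cdf k ≤ 1ℚ
cdf≤1 k = subst (cdf k ≤_) (cdf+½^ k) (p≤p+q (0≤½^ k))

cdf-suc : ∀ k → cdf (suc k) ≡ cdf k + ½^ (suc k)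
cdf-suc zero    = refl
cdf-suc (suc k) = ≡.trans (cong (λ p → ½ * 1ℚ + ½ * p) (cdf-suc k))
  (solve 2 (λ c h → con ½ :* con 1ℚ :+ con ½ :* (c :+ h) := (con ½ :* con 1ℚ :+ con ½ :* c) :+ con ½ :* h) refl (cdf k) (½^ (suc k)))

-- Capping only moves mass downwards, so lower tails can only grow.
cdf≤μ : ∀ L k → cdf k ≤ μ L (λ x → ⟦ x ℕ.≤ᵇ k ⟧)
cdf≤μ L       zero    = 0≤μ L (λ k → 0≤⟦ suc k ℕ.≤ᵇ 0 ⟧)
cdf≤μ zero    (suc k) = cdf≤1 (suc k)
cdf≤μ (suc L) (suc k) = +-monoʳ-≤ (½ * 1ℚ) (*-monoˡ-≤ 0≤½ (subst (cdf k ≤_) (μ-cong L (λ x → cong ⟦_⟧ (shift x k))) (cdf≤μ L k)))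
  where
  shift : ∀ x k → (x ℕ.≤ᵇ k) ≡ (suc x ℕ.≤ᵇ suc k)
  shift zero    k = refl
  shift (suc x) k = refl

-- Values up to `L` keep their geometric mass, and the cap `L + 1` collects the whole remaining
-- tail, which is more than its own share.
½^≤μ : ∀ L k → k ℕ.≤ L → ½^ (suc k) ≤ μ L (λ x → ⟦ x ℕ.≡ᵇ suc k ⟧)
½^≤μ zero    zero    _ = ≤-trans (≤-reflexive (*-identityʳ ½)) (toWitness {a? = ½ ≤? 1ℚ} tt)
½^≤μ (suc L) zero    _ = p≤p+q (0≤* 0≤½ (0≤μ L (λ k → 0≤⟦ suc (suc k) ℕ.≡ᵇ 1 ⟧)))
½^≤μ (suc L) (suc k) (s≤s k≤L) = ≤-trans (*-monoˡ-≤ 0≤½ (½^≤μ L k k≤L))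
  (≤-reflexive (≡.sym (≡.trans (cong (_+ ½ * μ L (λ x → ⟦ suc x ℕ.≡ᵇ suc (suc k) ⟧)) (*-zeroʳ ½)) (+-identityˡ _))))

ℕtoℚ-+ : ∀ k m → ℕtoℚ (k ℕ.+ m) ≡ ℕtoℚ k + ℕtoℚ m
ℕtoℚ-+ k m = ≡.sym (≡.trans
  (cong₂ _+_ (normalize-coprime (1-coprime k)) (normalize-coprime (1-coprime m)))
  (cong (λ i → i / 1) (cong₂ ℤ._+_ (ℤ.*-identityʳ (ℤ.+ k)) (ℤ.*-identityʳ (ℤ.+ m)))))
  where
  1-coprime : ∀ k → Coprime k 1
  1-coprime k = Coprime.sym (1-coprimeTo k)

0≤ℕtoℚ : ∀ k → 0ℚ ≤ ℕtoℚ k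
0≤ℕtoℚ k = nonNegative⁻¹ (ℕtoℚ k) {{normalize-nonNeg k 1}}

telescope : ∀ K (F t : ℕ → ℚ) → (∀ k → F (suc k) ≤ F k + t k) → F K ≤ F 0 + sum {K} (λ k → t (toℕ k))
telescope zero    F t h = ≤-reflexive (≡.sym (+-identityʳ (F 0)))
telescope (suc K) F t h = begin
  F (suc K)                                          ≤⟨ telescope K (F ∘ suc) (t ∘ suc) (h ∘ suc) ⟩
  F 1 + sum {K} (λ k → t (suc (toℕ k)))              ≤⟨ +-monoˡ-≤ _ (h 0) ⟩
  F 0 + t 0 + sum {K} (λ k → t (suc (toℕ k)))        ≡⟨ +-assoc (F 0) (t 0) _ ⟩
  F 0 + (t 0 + sum {K} (λ k → t (suc (toℕ k))))      ∎
  where open ≤-Reasoning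

-- The mean-value bound for the power `j + 1` on the interval from `b` to `b + δ`, with the
-- derivative taken at the larger end.
^-increment : ∀ {b δ} → 0ℚ ≤ b → 0ℚ ≤ δ → ∀ j →
              (b + δ) ^ suc j ≤ b ^ suc j + ℕtoℚ (suc j) * (δ * (b + δ) ^ j)
^-increment {b} {δ} 0≤b 0≤δ zero = ≤-reflexive
  (solve 2 (λ b δ → (b :+ δ) :* con 1ℚ := b :* con 1ℚ :+ con 1ℚ :* (δ :* con 1ℚ)) refl b δ)
^-increment {b} {δ} 0≤b 0≤δ (suc j) = begin
  a * a ^ suc j                                                   ≤⟨ *-monoˡ-≤ 0≤a (^-increment 0≤b 0≤δ j) ⟩
  a * (b ^ suc j + J * (δ * a ^ j))                               ≡⟨ solve 5 (λ b δ p J q → (b :+ δ) :* (p :+ J :* (δ :* q)) := b :* p :+ (δ :* p :+ J :* (δ :* ((b :+ δ) :* q)))) refl b δ (b ^ suc j) J (a ^ j) ⟩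
  b ^ suc (suc j) + (δ * b ^ suc j + J * (δ * a ^ suc j))         ≤⟨ +-monoʳ-≤ (b ^ suc (suc j)) (+-monoˡ-≤ (J * (δ * a ^ suc j)) (*-monoˡ-≤ 0≤δ (^-mono (suc j)))) ⟩
  b ^ suc (suc j) + (δ * a ^ suc j + J * (δ * a ^ suc j))         ≡⟨ cong (b ^ suc (suc j) +_) (solve 2 (λ x J → x :+ J :* x := (con 1ℚ :+ J) :* x) refl (δ * a ^ suc j) J) ⟩
  b ^ suc (suc j) + (1ℚ + J) * (δ * a ^ suc j)                    ≡⟨ cong (λ x → b ^ suc (suc j) + x * (δ * a ^ suc j)) (ℕtoℚ-+ 1 (suc j)) ⟨
  b ^ suc (suc j) + ℕtoℚ (suc (suc j)) * (δ * a ^ suc j)          ∎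
  where
  open ≤-Reasoning
  a J : ℚ
  a = b + δ
  J = ℕtoℚ (suc j)
  0≤a : 0ℚ ≤ a
  0≤a = 0≤+ 0≤b 0≤δ
  ^-mono : ∀ i → b ^ i ≤ a ^ i
  ^-mono zero    = ≤-refl
  ^-mono (suc i) = *-mono-≤ 0≤a (0≤^ i 0≤b) (p≤p+q {b} {δ} 0≤δ) (^-mono i)

-- The k-th term is the mass of value k + 2 times the probability that j other values are at most k + 1.
strictMax : ℕ → ℕ → ℚ
strictMax L j = sum {L} (λ k → ½^ (suc (suc (toℕ k))) * cdf (suc (toℕ k)) ^ j)

-- Telescope the power `j + 1` of `cdf` from 0 to `L`. By the mean-value bound the `k`-th increment
-- is at most `j + 1` times twice the `k`-th term of `strictMax`; the factor two is the ½ on the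
-- left.
cdf^≤strictMax : ∀ L j → ½ * cdf L ^ suc j ≤ ℕtoℚ (suc j) * strictMax L j
cdf^≤strictMax L j = begin
  ½ * cdf L ^ suc j                          ≤⟨ *-monoˡ-≤ 0≤½ (telescope L (λ k → cdf k ^ suc j) t increment) ⟩
  ½ * (0ℚ * 0ℚ ^ j + sum {L} (λ k → t (toℕ k)))       ≡⟨ cong (λ x → ½ * (x + sum {L} (λ k → t (toℕ k)))) (*-zeroˡ (0ℚ ^ j)) ⟩
  ½ * (0ℚ + sum {L} (λ k → t (toℕ k)))       ≡⟨ cong (½ *_) (+-identityˡ (sum {L} (λ k → t (toℕ k)))) ⟩
  ½ * sum {L} (λ k → t (toℕ k))              ≡⟨ *-distribˡ-sum {L} ½ (λ k → t (toℕ k)) ⟩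
  sum {L} (λ k → ½ * t (toℕ k))              ≡⟨ sum-cong-≗ {L} (λ k → solve 4 (λ h J p q → h :* (J :* (p :* q)) := J :* ((h :* p) :* q)) refl ½ J (½^ (suc (toℕ k))) (cdf (suc (toℕ k)) ^ j)) ⟩
  sum {L} (λ k → J * (½^ (suc (suc (toℕ k))) * cdf (suc (toℕ k)) ^ j))     ≡⟨ *-distribˡ-sum {L} J _ ⟨
  J * strictMax L j                          ∎
  where
  open ≤-Reasoning
  J = ℕtoℚ (suc j)
  t : ℕ → ℚ
  t k = J * (½^ (suc k) * cdf (suc k) ^ j)
  increment : ∀ k → cdf (suc k) ^ suc j ≤ cdf k ^ suc j + t k
  increment k = subst (λ a → a ^ suc j ≤ cdf k ^ suc j + J * (½^ (suc k) * a ^ j)) (≡.sym (cdf-suc k))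
                  (^-increment (0≤cdf k) (0≤½^ (suc k)) j)

-- Bernoulli's inequality for `cdf L`, which is 1 minus `½^ L`, with the subtraction moved to the
-- other side.
bernoulli : ∀ L M → 1ℚ ≤ cdf L ^ M + ℕtoℚ M * ½^ L
bernoulli L zero    = ≤-reflexive (≡.sym (≡.trans (cong (1ℚ +_) (*-zeroˡ (½^ L))) refl))
bernoulli L (suc M) = begin
  1ℚ                                          ≡⟨ cdf+½^ L ⟨
  c + h                                       ≡⟨ cong (_+ h) (*-identityʳ c) ⟨
  c * 1ℚ + h                                  ≤⟨ +-monoˡ-≤ h (*-monoˡ-≤ (0≤cdf L) (bernoulli L M)) ⟩
  c * (c ^ M + m * h) + h                     ≡⟨ cong (_+ h) (*-distribˡ-+ c (c ^ M) (m * h)) ⟩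
  (c * c ^ M + c * (m * h)) + h               ≤⟨ +-monoˡ-≤ h (+-monoʳ-≤ (c * c ^ M) (*-monoʳ-≤-nonNeg (m * h) {{nonNegative (0≤* (0≤ℕtoℚ M) (0≤½^ L))}} (cdf≤1 L))) ⟩
  (c * c ^ M + 1ℚ * (m * h)) + h              ≡⟨ solve 3 (λ x m h → (x :+ con 1ℚ :* (m :* h)) :+ h := x :+ (con 1ℚ :+ m) :* h) refl (c * c ^ M) m h ⟩
  c * c ^ M + (1ℚ + m) * h                    ≡⟨ cong (λ x → c * c ^ M + x * h) (ℕtoℚ-+ 1 M) ⟨
  c ^ suc M + ℕtoℚ (suc M) * h                ∎
  where
  open ≤-Reasoning
  c = cdf L
  h = ½^ L
  m = ℕtoℚ M

m½^m≤1 : ∀ m → ℕtoℚ m * ½^ m ≤ 1ℚ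
m½^m≤1 zero = 0≤1
m½^m≤1 (suc m) = begin
  ℕtoℚ (suc m) * (½ * ½^ m)                 ≡⟨ cong (_* (½ * ½^ m)) (ℕtoℚ-+ 1 m) ⟩
  (1ℚ + ℕtoℚ m) * (½ * ½^ m)                ≡⟨ solve 2 (λ m h → (con 1ℚ :+ m) :* (con ½ :* h) := con ½ :* h :+ con ½ :* (m :* h)) refl (ℕtoℚ m) (½^ m) ⟩
  ½ * ½^ m + ½ * (ℕtoℚ m * ½^ m)            ≤⟨ +-mono-≤ (*-monoˡ-≤ 0≤½ ½^m≤1) (*-monoˡ-≤ 0≤½ (m½^m≤1 m)) ⟩
  ½ * 1ℚ + ½ * 1ℚ                           ≡⟨⟩
  1ℚ                                        ∎
  where
  open ≤-Reasoning
  ½^m≤1 : ½^ m ≤ 1ℚ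
  ½^m≤1 = subst (½^ m ≤_) (≡.trans (+-comm (½^ m) (cdf m)) (cdf+½^ m)) (p≤p+q (0≤cdf m))

½^-antitone : ∀ {k m} → k ℕ.≤ m → ½^ m ≤ ½^ k
½^-antitone {m = zero}  z≤n       = ≤-refl
½^-antitone {m = suc m} z≤n       = ≤-trans (*-monoˡ-≤ 0≤½ (½^-antitone {m = m} z≤n)) (toWitness {a? = ½ * 1ℚ ≤? 1ℚ} tt)
½^-antitone             (s≤s k≤m) = *-monoˡ-≤ 0≤½ (½^-antitone k≤m)

⅖ : ℚ
⅖ = ℤ.+ 2 / 5

-- For `M = j + 1` the three extra units in the cap give `M * ½^ L ≤ 1/8`, hence `cdf L ^ M ≥ 7/8`
-- by Bernoulli. Half of this is 7/16, which exceeds 2/5; the value 2/5 is chosen to yield the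
-- factor 5 in `pairs≤removed`.
strictMax-bound : ∀ L j → 3 ℕ.+ suc j ℕ.≤ L → ⅖ ≤ ℕtoℚ (suc j) * strictMax L j
strictMax-bound L j 3+M≤L = ≤-trans (≤-trans (toWitness {a? = ⅖ ≤? ½ * ⅞} tt) (*-monoˡ-≤ 0≤½ ⅞≤)) (cdf^≤strictMax L j)
  where
  open ≤-Reasoning
  M = suc j
  ⅞ ⅛ : ℚ
  ⅞ = ℤ.+ 7 / 8
  ⅛ = ℤ.+ 1 / 8
  M½^L≤⅛ : ℕtoℚ M * ½^ L ≤ ⅛
  M½^L≤⅛ = begin
    ℕtoℚ M * ½^ L                        ≤⟨ *-monoˡ-≤ (0≤ℕtoℚ M) (½^-antitone 3+M≤L) ⟩
    ℕtoℚ M * (½ * (½ * (½ * ½^ M)))      ≡⟨ solve 2 (λ m h → m :* (con ½ :* (con ½ :* (con ½ :* h))) := con ⅛ :* (m :* h)) refl (ℕtoℚ M) (½^ M) ⟩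
    ⅛ * (ℕtoℚ M * ½^ M)                  ≤⟨ *-monoˡ-≤ (nonNegative⁻¹ ⅛) (m½^m≤1 M) ⟩
    ⅛                                    ∎
  ⅞≤ : ⅞ ≤ cdf L ^ M
  ⅞≤ = begin
    ⅞                                           ≡⟨⟩
    1ℚ + - ⅛                                    ≤⟨ +-monoˡ-≤ (- ⅛) (bernoulli L M) ⟩
    cdf L ^ M + ℕtoℚ M * ½^ L + - ⅛             ≤⟨ +-monoˡ-≤ (- ⅛) (+-monoʳ-≤ (cdf L ^ M) M½^L≤⅛) ⟩
    cdf L ^ M + ⅛ + - ⅛                         ≡⟨ +-assoc (cdf L ^ M) ⅛ (- ⅛) ⟩
    cdf L ^ M + 0ℚ                              ≡⟨ +-identityʳ _ ⟩
    cdf L ^ M                                   ∎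

-- From truncated sums to the capped law

sumℚ-++ : ∀ xs ys → sumℚ (xs ++ ys) ≡ sumℚ xs + sumℚ ys
sumℚ-++ []       ys = ≡.sym (+-identityˡ _)
sumℚ-++ (x ∷ xs) ys = ≡.trans (cong (x +_) (sumℚ-++ xs ys)) (≡.sym (+-assoc x (sumℚ xs) (sumℚ ys)))

sumℚ-* : ∀ {A : Set} c (f : A → ℚ) xs → sumℚ (map (λ x → c * f x) xs) ≡ c * sumℚ (map f xs)
sumℚ-* c f []       = ≡.sym (*-zeroʳ c)
sumℚ-* c f (x ∷ xs) = ≡.trans (cong (c * f x +_) (sumℚ-* c f xs)) (≡.sym (*-distribˡ-+ c (f x) _))

sumℚ-concatMap : ∀ {A B : Set} (f : B → ℚ) (k : A → List B) xs →
                 sumℚ (map f (concatMap k xs)) ≡ sumℚ (map (λ x → sumℚ (map f (k x))) xs)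
sumℚ-concatMap f k []       = refl
sumℚ-concatMap f k (x ∷ xs) = begin
  sumℚ (map f (k x ++ concatMap k xs))                     ≡⟨ cong sumℚ (map-++ f (k x) (concatMap k xs)) ⟩
  sumℚ (map f (k x) ++ map f (concatMap k xs))             ≡⟨ sumℚ-++ (map f (k x)) _ ⟩
  sumℚ (map f (k x)) + sumℚ (map f (concatMap k xs))       ≡⟨ cong (sumℚ (map f (k x)) +_) (sumℚ-concatMap f k xs) ⟩
  sumℚ (map (λ x → sumℚ (map f (k x))) (x ∷ xs))           ∎
  where open ≡.≡-Reasoning

sumℚ-range : ∀ (f : ℕ → ℚ) N → sumℚ (map f (range N)) ≡ sum {N} (λ i → f (suc (toℕ i)))
sumℚ-range f N = ≡.trans (cong (λ xs → sumℚ (map f xs)) (map-applyUpTo id suc N)) (go suc N)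
  where
  go : ∀ (h : ℕ → ℕ) N → sumℚ (map f (applyUpTo h N)) ≡ sum {N} (λ i → f (h (toℕ i)))
  go h zero    = refl
  go h (suc N) = cong (f (h 0) +_) (go (h ∘ suc) N)

-- As `N ≤ L`, the values 1 to `N` lie below the cap and keep their geometric mass; the rest of the
-- law contributes a nonnegative amount.
range-sum≤μ : ∀ {N L} → N ℕ.≤ L → (f : ℕ → ℚ) → (∀ k → 0ℚ ≤ f (suc k)) →
              sum {N} (λ i → ½^ (suc (toℕ i)) * f (suc (toℕ i))) ≤ μ L f
range-sum≤μ {L = L} z≤n       f 0≤f = 0≤μ L 0≤f
range-sum≤μ {suc N} {suc L} (s≤s N≤L) f 0≤f = begin
  ½ * 1ℚ * f 1 + sum {N} (λ i → ½ * ½^ (suc (toℕ i)) * f (suc (suc (toℕ i))))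
    ≡⟨ cong (½ * f 1 +_) (≡.trans (sum-cong-≗ {N} (λ i → *-assoc ½ (½^ (suc (toℕ i))) (f (suc (suc (toℕ i))))))
                                  (≡.sym (*-distribˡ-sum {N} ½ (λ i → ½^ (suc (toℕ i)) * f (suc (suc (toℕ i))))))) ⟩
  ½ * f 1 + ½ * sum {N} (λ i → ½^ (suc (toℕ i)) * f (suc (suc (toℕ i))))
    ≤⟨ +-monoʳ-≤ (½ * f 1) (*-monoˡ-≤ 0≤½ (range-sum≤μ N≤L (f ∘ suc) (0≤f ∘ suc))) ⟩
  μ (suc L) f ∎
  where open ≤-Reasoning

foldr-tabulate : ∀ {m} (ℓ : Fin m → ℕ) (h : Fin n → Fin m) →
                 foldr (λ v q → ½^ (ℓ v) * q) 1ℚ (tabulate h) ≡ prod (λ i → ½^ (ℓ (h i)))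
foldr-tabulate {zero}  ℓ h = refl
foldr-tabulate {suc n} ℓ h = cong (½^ (ℓ (h zero)) *_) (foldr-tabulate ℓ (h ∘ suc))

weight-∷ : ∀ x (ℓ : Fin n → ℕ) → weight (x ∷ᶠ ℓ) ≡ ½^ x * weight ℓ
weight-∷ x ℓ = cong (½^ x *_) (≡.trans (foldr-tabulate (x ∷ᶠ ℓ) suc) (≡.sym (foldr-tabulate ℓ id)))

truncExp : ℕ → ((Fin n → ℕ) → ℚ) → ℚ
truncExp {n} N f = sumℚ (map (λ ℓ → weight ℓ * f ℓ) (allAssign n (range N)))

-- Domination is asked for only inside the truncation box, so `g` may vanish on every assignment
-- that reaches the cap.
truncExp≤𝔼 : ∀ {N L} → N ℕ.≤ L → {f g : (Fin n → ℕ) → ℚ} →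
              (∀ ℓ → (∀ v → ℓ v ℕ.≤ N) → f ℓ ≤ g ℓ) → (∀ ℓ → 0ℚ ≤ g ℓ) → truncExp N f ≤ 𝔼 L g
truncExp≤𝔼 {zero}  {N} {L} N≤L {f} {g} f≤g 0≤g =
  ≤-trans (≤-reflexive (≡.trans (+-identityʳ (1ℚ * f _)) (*-identityˡ (f _)))) (f≤g _ λ ())
truncExp≤𝔼 {suc n} {N} {L} N≤L {f} {g} f≤g 0≤g = begin
  sumℚ (map w (concatMap (λ x → map (x ∷ᶠ_) (allAssign n (range N))) (range N)))
    ≡⟨ sumℚ-concatMap w (λ x → map (x ∷ᶠ_) (allAssign n (range N))) (range N) ⟩
  sumℚ (map (λ x → sumℚ (map w (map (x ∷ᶠ_) (allAssign n (range N))))) (range N))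
    ≡⟨ cong sumℚ (map-cong slice (range N)) ⟩
  sumℚ (map (λ x → ½^ x * truncExp N (f ∘ (x ∷ᶠ_))) (range N))
    ≡⟨ sumℚ-range (λ x → ½^ x * truncExp N (f ∘ (x ∷ᶠ_))) N ⟩
  sum {N} (λ i → ½^ (suc (toℕ i)) * truncExp N (f ∘ (suc (toℕ i) ∷ᶠ_)))
    ≤⟨ sum-mono {N} (λ i → *-monoˡ-≤ (0≤½^ (suc (toℕ i))) (truncExp≤𝔼 N≤L
         (λ ℓ ℓ≤N → f≤g (suc (toℕ i) ∷ᶠ ℓ) (λ { zero → toℕ<n i ; (suc v) → ℓ≤N v }))
         (λ ℓ → 0≤g (suc (toℕ i) ∷ᶠ ℓ)))) ⟩
  sum {N} (λ i → ½^ (suc (toℕ i)) * 𝔼 L (g ∘ (suc (toℕ i) ∷ᶠ_)))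
    ≤⟨ range-sum≤μ N≤L (λ x → 𝔼 L (g ∘ (x ∷ᶠ_))) (λ x → 0≤𝔼 L (λ ℓ _ → 0≤g (suc x ∷ᶠ ℓ))) ⟩
  𝔼 L g ∎
  where
  open ≤-Reasoning
  w : (Fin (suc n) → ℕ) → ℚ
  w ℓ = weight ℓ * f ℓ
  slice : ∀ x → sumℚ (map w (map (x ∷ᶠ_) (allAssign n (range N)))) ≡ ½^ x * truncExp N (f ∘ (x ∷ᶠ_))
  slice x = ≡.trans (cong sumℚ (≡.trans (≡.sym (map-∘ (allAssign n (range N))))
      (map-cong (λ ℓ → ≡.trans (cong (_* f (x ∷ᶠ ℓ)) (weight-∷ x ℓ)) (*-assoc (½^ x) (weight ℓ) (f (x ∷ᶠ ℓ)))) (allAssign n (range N)))))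
    (sumℚ-* (½^ x) (λ ℓ → weight ℓ * f (x ∷ᶠ ℓ)) (allAssign n (range N)))

truncExp3≡ : ∀ N (X : (Fin n → ℕ) → (Fin n → ℕ) → (Fin n → ℕ) → ℕ) →
             truncExp3 N X ≡ truncExp N (λ ℓ₀ → truncExp N (λ ℓ₁ → truncExp N (λ ℓ₂ → ℕtoℚ (X ℓ₀ ℓ₁ ℓ₂))))
truncExp3≡ {n} N X = cong sumℚ (map-cong (λ ℓ₀ → ≡.trans
    (cong sumℚ (map-cong (λ ℓ₁ → ≡.trans
        (cong sumℚ (map-cong (λ ℓ₂ → solve 4 (λ a b c x → a :* b :* c :* x := (a :* b) :* (c :* x)) refl
                                       (weight ℓ₀) (weight ℓ₁) (weight ℓ₂) (ℕtoℚ (X ℓ₀ ℓ₁ ℓ₂))) as))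
        (≡.trans (sumℚ-* (weight ℓ₀ * weight ℓ₁) (λ ℓ₂ → weight ℓ₂ * ℕtoℚ (X ℓ₀ ℓ₁ ℓ₂)) as)
                 (*-assoc (weight ℓ₀) (weight ℓ₁) _))) as))
    (sumℚ-* (weight ℓ₀) (λ ℓ₁ → weight ℓ₁ * truncExp N (λ ℓ₂ → ℕtoℚ (X ℓ₀ ℓ₁ ℓ₂))) as)) as)
  where as = allAssign n (range N)

-- Edge counts as sums over ordered pairs

sum-map-tabulate : ∀ {m} (f : Fin m → ℕ) (h : Fin n → Fin m) →
                   ℕtoℚ (sumℕ (map f (tabulate h))) ≡ sum (λ i → ℕtoℚ (f (h i)))
sum-map-tabulate {zero}  f h = refl
sum-map-tabulate {suc n} f h = ≡.trans (ℕtoℚ-+ (f (h zero)) (sumℕ (map f (tabulate (h ∘ suc))))) (cong (ℕtoℚ (f (h zero)) +_) (sum-map-tabulate f (h ∘ suc)))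

∑∑ : (Fin n → Fin n → ℚ) → ℚ
∑∑ f = sum (λ u → sum (λ v → f u v))

countPairs-sum : (P : Fin n → Fin n → Bool) →
                 ℕtoℚ (countPairs P) ≡ ∑∑ (λ u v → ⟦ (toℕ u ℕ.<ᵇ toℕ v) ∧ P u v ⟧)
countPairs-sum {n} P = ≡.trans (sum-map-tabulate row id) (sum-cong-≗ {n} (λ u →
  ≡.trans (sum-map-tabulate (entry u) id) (sum-cong-≗ {n} (λ v → if-⟦⟧ ((toℕ u ℕ.<ᵇ toℕ v) ∧ P u v)))))
  where
  entry : Fin n → Fin n → ℕ
  entry u v = if (toℕ u ℕ.<ᵇ toℕ v) ∧ P u v then 1 else 0
  row : Fin n → ℕ
  row u = sumℕ (map (entry u) (allFin n))
  if-⟦⟧ : ∀ b → ℕtoℚ (if b then 1 else 0) ≡ ⟦ b ⟧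
  if-⟦⟧ true  = refl
  if-⟦⟧ false = refl

-- Every unordered pair occurs in both orders and the diagonal is empty. Ordered pairs treat both
-- ends of an edge alike, which suits charging edges to their ends.
∑∑-pairs : (P : Fin n → Fin n → Bool) → (∀ u v → P u v ≡ P v u) → (∀ v → P v v ≡ false) →
           ∑∑ (λ u v → ⟦ P u v ⟧) ≡ ℕtoℚ (countPairs P) + ℕtoℚ (countPairs P)
∑∑-pairs {n} P P-sym P-irrefl = begin
  ∑∑ (λ u v → ⟦ P u v ⟧)                                                     ≡⟨ sum-cong-≗ (λ u → sum-cong-≗ (λ v → split u v)) ⟩
  ∑∑ (λ u v → ⟦ up u v ⟧ + ⟦ up v u ⟧)                                       ≡⟨ sum-cong-≗ (λ u → ∑-distrib-+ (λ v → ⟦ up u v ⟧) (λ v → ⟦ up v u ⟧)) ⟩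
  sum (λ u → sum (λ v → ⟦ up u v ⟧) + sum (λ v → ⟦ up v u ⟧))                ≡⟨ ∑-distrib-+ (λ u → sum (λ v → ⟦ up u v ⟧)) (λ u → sum (λ v → ⟦ up v u ⟧)) ⟩
  ∑∑ (λ u v → ⟦ up u v ⟧) + ∑∑ (λ u v → ⟦ up v u ⟧)                          ≡⟨ cong (∑∑ (λ u v → ⟦ up u v ⟧) +_) (∑-comm (λ u v → ⟦ up v u ⟧)) ⟩
  ∑∑ (λ u v → ⟦ up u v ⟧) + ∑∑ (λ u v → ⟦ up u v ⟧)                          ≡⟨ cong₂ _+_ (countPairs-sum P) (countPairs-sum P) ⟨
  ℕtoℚ (countPairs P) + ℕtoℚ (countPairs P)                                  ∎
  where
  open ≡.≡-Reasoning
  up : Fin n → Fin n → Bool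
  up u v = (toℕ u ℕ.<ᵇ toℕ v) ∧ P u v
  <⇒true : ∀ {a b} → a ℕ.< b → (a ℕ.<ᵇ b) ≡ true
  <⇒true a<b = Equivalence.to T-≡ (ℕ.<⇒<ᵇ a<b)
  ≮⇒false : ∀ {a b} → (a ℕ.< b → ⊥) → (a ℕ.<ᵇ b) ≡ false
  ≮⇒false {a} {b} a≮b with a ℕ.<ᵇ b in eq
  ... | false = refl
  ... | true  = ⊥-elim (a≮b (ℕ.<ᵇ⇒< a b (Equivalence.from T-≡ eq)))
  split : ∀ u v → ⟦ P u v ⟧ ≡ ⟦ up u v ⟧ + ⟦ up v u ⟧
  split u v with ℕ.<-cmp (toℕ u) (toℕ v)
  ... | tri< u<v _ v≮u rewrite <⇒true u<v | ≮⇒false v≮u = ≡.sym (+-identityʳ ⟦ P u v ⟧)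
  ... | tri> u≮v _ v<u rewrite <⇒true v<u | ≮⇒false u≮v = ≡.trans (cong ⟦_⟧ (P-sym u v)) (≡.sym (+-identityˡ ⟦ P v u ⟧))
  ... | tri≈ u≮v u≡v v≮u rewrite ≮⇒false u≮v | ≮⇒false v≮u | toℕ-injective u≡v | P-irrefl v = refl

-- The protocol in one round

∧⁺ : ∀ {a b} → T a → T b → T (a ∧ b)
∧⁺ p q = Equivalence.from T-∧ (p , q)

∧⁻ : ∀ {a b} → T (a ∧ b) → T a × T b
∧⁻ = Equivalence.to T-∧

∨⁻ : ∀ {a b} → T (a ∨ b) → T a ⊎ T b
∨⁻ = Equivalence.to T-∨

∨⁺ : ∀ {a b} → T a ⊎ T b → T (a ∨ b)
∨⁺ = Equivalence.from T-∨

not⁺ : ∀ {a} → ¬ T a → T (not a)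
not⁺ {true}  ¬a = ⊥-elim (¬a tt)
not⁺ {false} ¬a = tt

not⁻ : ∀ {a} → T (not a) → ¬ T a
not⁻ {false} _ ()

any-agent⁺ : (p : Fin n → Bool) → ∀ v → T (p v) → T (anyAgent p)
any-agent⁺ p v pv = any⁺ p (lose (∈-allFin v) pv)

any-agent⁻ : (p : Fin n → Bool) → T (anyAgent p) → ∃ λ v → T (p v)
any-agent⁻ p h with find (any⁻ p (allFin _) h)
... | v , _ , pv = v , pv

isIn⁺ : ∀ {x} → x ≡ In → T (isIn x)
isIn⁺ refl = tt

isIn⁻ : ∀ {x} → T (isIn x) → x ≡ In
isIn⁻ {In} _ = refl

isEven-2* : ∀ k → isEven (2 ℕ.* k) ≡ true
isEven-2* zero    = refl
isEven-2* (suc k) rewrite ℕ.+-suc k (k ℕ.+ 0) = isEven-2* k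

isEven-suc-2* : ∀ k → isEven (suc (2 ℕ.* k)) ≡ false
isEven-suc-2* zero    = refl
isEven-suc-2* (suc k) rewrite ℕ.+-suc k (k ℕ.+ 0) = isEven-suc-2* k

-- The transition table of `step` with the three relevant notes abstracted to Booleans, so that its
-- case analysis stays free of `hears`.
next : St → Bool → Bool → Bool → St
next In  heardEven heard0 heardOdd = if heardEven then Un else In
next Un  heardEven heard0 heardOdd = if heard0 then Out else (if heardOdd then Un else In)
next Out heardEven heard0 heardOdd = if heard0 then Out else Un

next-In⁺ : ∀ {t e z o} → (t ≡ In × ¬ T e) ⊎ (t ≡ Un × ¬ T z × ¬ T o) → next t e z o ≡ In
next-In⁺ {e = false}                 (inj₁ (refl , _))       = refl
next-In⁺ {e = true}                  (inj₁ (refl , ¬e))      = ⊥-elim (¬e tt)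
next-In⁺ {z = true}                  (inj₂ (refl , ¬z , _))  = ⊥-elim (¬z tt)
next-In⁺ {z = false} {o = true}      (inj₂ (refl , _ , ¬o))  = ⊥-elim (¬o tt)
next-In⁺ {z = false} {o = false}     (inj₂ (refl , _ , _))   = refl

next-In⁻ : ∀ t e z o → next t e z o ≡ In → (t ≡ In × ¬ T e) ⊎ (t ≡ Un × ¬ T z × ¬ T o)
next-In⁻ In  false z     o     _ = inj₁ (refl , id)
next-In⁻ Un  e     false false _ = inj₂ (refl , id , id)
next-In⁻ Un  e     false true  ()
next-In⁻ Un  e     true  o     ()
next-In⁻ Out e     true  o     ()
next-In⁻ Out e     false o     ()

next-Out⁺ : ∀ {t e z o} → t ≢ In → T z → next t e z o ≡ Out
next-Out⁺ {In}              t≢In _ = ⊥-elim (t≢In refl)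
next-Out⁺ {Un}  {z = true}  _    _ = refl
next-Out⁺ {Out} {z = true}  _    _ = refl

next-Out⁻ : ∀ {t e z o} → t ≢ In → next t e z o ≡ Out → T z
next-Out⁻ {In}                          t≢In _ = ⊥-elim (t≢In refl)
next-Out⁻ {Un}  {z = true}              _    _ = tt
next-Out⁻ {Un}  {z = false} {o = true}  _    ()
next-Out⁻ {Un}  {z = false} {o = false} _    ()
next-Out⁻ {Out} {z = true}              _    _ = tt

module Step (G : Graph n) (s : Fin n → St) (ℓ : Fin n → ℕ) where

  -- An `Un` agent with an `In` neighbour hears note 0 and becomes `Out`, so it cannot compete.
  -- Together with `Unbeaten` this characterises the agents that are `In` after the step.
  Candidate : Fin n → Set
  Candidate x = s x ≡ In ⊎ (s x ≡ Un × (∀ y → T (adj G x y) → s y ≢ In))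

  -- Only neighbours in the same state are compared, since `In` agents sing even notes and `Un`
  -- agents odd ones. Ties are harmless: the first note beyond its own is sung to `x` only by a
  -- strictly larger value.
  Unbeaten : Fin n → Set
  Unbeaten x = ∀ y → T (adj G x y) → s y ≡ s x → ℓ y ℕ.≤ ℓ x

  hears⁻ : ∀ x k → T (hears G s ℓ x k) → ∃ λ y → T (adj G x y) × T (sings (s y) (ℓ y) k)
  hears⁻ x k h with any-agent⁻ _ (proj₂ (∧⁻ {not (sings (s x) (ℓ x) k)} h))
  ... | y , adj∧sings = y , ∧⁻ adj∧sings

  hears⁺ : ∀ x k y → ¬ T (sings (s x) (ℓ x) k) → T (adj G x y) → T (sings (s y) (ℓ y) k) → T (hears G s ℓ x k)
  hears⁺ x k y silent xy sing = ∧⁺ (not⁺ silent) (any-agent⁺ _ y (∧⁺ xy sing))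

  sings-0⁻ : ∀ t m → T (sings t m 0) → t ≡ In
  sings-0⁻ In m _ = refl

  sings-0⁺ : ∀ {t m} → 1 ℕ.≤ m → t ≡ In → T (sings t m 0)
  sings-0⁺ {m = suc m} _ refl = tt

  sings-even⁻ : ∀ t m k → T (sings t m (2 ℕ.* k)) → t ≡ In × k ℕ.< m
  sings-even⁻ In m k h = refl , ℕ.*-cancelˡ-< 2 k m (ℕ.<ᵇ⇒< _ _ (proj₂ (∧⁻ {isEven (2 ℕ.* k)} h)))
  sings-even⁻ Un m k h rewrite isEven-2* k = ⊥-elim h

  sings-even⁺ : ∀ {t m k} → t ≡ In → k ℕ.< m → T (sings t m (2 ℕ.* k))
  sings-even⁺ {k = k} refl k<m = ∧⁺ (Equivalence.from T-≡ (isEven-2* k)) (ℕ.<⇒<ᵇ (ℕ.*-monoʳ-< 2 k<m))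

  odd<⇒< : ∀ k m → suc (2 ℕ.* k) ℕ.< 2 ℕ.* m → k ℕ.< m
  odd<⇒< k m h = ℕ.*-cancelˡ-< 2 k m (ℕ.<-trans (ℕ.n<1+n _) h)

  <⇒odd< : ∀ k m → k ℕ.< m → suc (2 ℕ.* k) ℕ.< 2 ℕ.* m
  <⇒odd< k m k<m = subst (ℕ._≤ 2 ℕ.* m) (cong suc (ℕ.+-suc k (k ℕ.+ 0))) (ℕ.*-monoʳ-≤ 2 k<m)

  sings-odd⁻ : ∀ t m k → T (sings t m (suc (2 ℕ.* k))) → t ≡ Un × k ℕ.< m
  sings-odd⁻ In m k h rewrite isEven-suc-2* k = ⊥-elim h
  sings-odd⁻ Un m k h = refl , odd<⇒< k m (ℕ.<ᵇ⇒< _ _ (proj₂ (∧⁻ {not (isEven (suc (2 ℕ.* k)))} h)))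

  sings-odd⁺ : ∀ {t m k} → t ≡ Un → k ℕ.< m → T (sings t m (suc (2 ℕ.* k)))
  sings-odd⁺ {m = m} {k} refl k<m =
    ∧⁺ (Equivalence.from T-not-≡ (isEven-suc-2* k)) (ℕ.<⇒<ᵇ (<⇒odd< k m k<m))

  hearsAs : Fin n → St → ℕ → Bool
  hearsAs x t k = not (sings t (ℓ x) k) ∧ anyAgent (λ u → adj G x u ∧ sings (s u) (ℓ u) k)

  -- Splitting on s x replaces it inside hears on the right-hand side too, but not in the unfolding of step.
  step-next : ∀ x → step G s ℓ x ≡
              next (s x) (hears G s ℓ x (2 ℕ.* ℓ x)) (hears G s ℓ x 0) (hears G s ℓ x (suc (2 ℕ.* ℓ x)))
  step-next x with s x in eq
  ... | Out = cong (λ t → next Out false (hearsAs x t 0) false) eq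
  ... | In  = cong (λ t → next In (hearsAs x t (2 ℕ.* ℓ x)) false false) eq
  ... | Un  = cong (λ t → next Un false (hearsAs x t 0) (hearsAs x t (suc (2 ℕ.* ℓ x)))) eq

  hears-0⁻ : ∀ x → (∀ y → T (adj G x y) → s y ≢ In) → ¬ T (hears G s ℓ x 0)
  hears-0⁻ x no-In h with hears⁻ x 0 h
  ... | y , xy , sing = no-In y xy (sings-0⁻ (s y) (ℓ y) sing)

  -- Positivity matters: an `In` agent with value 0 would sing nothing.
  hears-0⁺ : Pos ℓ → ∀ x y → s x ≢ In → T (adj G x y) → s y ≡ In → T (hears G s ℓ x 0)
  hears-0⁺ pos x y x≢In xy y-In = hears⁺ x 0 y (x≢In ∘ sings-0⁻ (s x) (ℓ x)) xy (sings-0⁺ (pos y) y-In)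

  hears-even⁻ : ∀ x → s x ≡ In → Unbeaten x → ¬ T (hears G s ℓ x (2 ℕ.* ℓ x))
  hears-even⁻ x x-In unbeaten h with hears⁻ x (2 ℕ.* ℓ x) h
  ... | y , xy , sing with sings-even⁻ (s y) (ℓ y) (ℓ x) sing
  ...   | y-In , x<y = ℕ.<⇒≱ x<y (unbeaten y xy (≡.trans y-In (≡.sym x-In)))

  hears-even⁺ : ∀ x → s x ≡ In → ¬ T (hears G s ℓ x (2 ℕ.* ℓ x)) → Unbeaten x
  hears-even⁺ x x-In unheard y xy sy≡sx = ℕ.≮⇒≥ λ x<y →
    unheard (hears⁺ x (2 ℕ.* ℓ x) y (λ h → ℕ.<-irrefl refl (proj₂ (sings-even⁻ (s x) (ℓ x) (ℓ x) h)))
              xy (sings-even⁺ (≡.trans sy≡sx x-In) x<y))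

  hears-odd⁻ : ∀ x → s x ≡ Un → Unbeaten x → ¬ T (hears G s ℓ x (suc (2 ℕ.* ℓ x)))
  hears-odd⁻ x x-Un unbeaten h with hears⁻ x (suc (2 ℕ.* ℓ x)) h
  ... | y , xy , sing with sings-odd⁻ (s y) (ℓ y) (ℓ x) sing
  ...   | y-Un , x<y = ℕ.<⇒≱ x<y (unbeaten y xy (≡.trans y-Un (≡.sym x-Un)))

  hears-odd⁺ : ∀ x → s x ≡ Un → ¬ T (hears G s ℓ x (suc (2 ℕ.* ℓ x))) → Unbeaten x
  hears-odd⁺ x x-Un unheard y xy sy≡sx = ℕ.≮⇒≥ λ x<y →
    unheard (hears⁺ x (suc (2 ℕ.* ℓ x)) y (λ h → ℕ.<-irrefl refl (proj₂ (sings-odd⁻ (s x) (ℓ x) (ℓ x) h)))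
              xy (sings-odd⁺ (≡.trans sy≡sx x-Un) x<y))

  step-In⁺ : ∀ x → Candidate x → Unbeaten x → step G s ℓ x ≡ In
  step-In⁺ x (inj₁ x-In) unbeaten =
    ≡.trans (step-next x) (next-In⁺ (inj₁ (x-In , hears-even⁻ x x-In unbeaten)))
  step-In⁺ x (inj₂ (x-Un , no-In)) unbeaten =
    ≡.trans (step-next x) (next-In⁺ (inj₂ (x-Un , hears-0⁻ x no-In , hears-odd⁻ x x-Un unbeaten)))

  step-In⁻ : Pos ℓ → ∀ x → step G s ℓ x ≡ In → Candidate x × Unbeaten x
  step-In⁻ pos x step≡In with next-In⁻ (s x) _ _ _ (≡.trans (≡.sym (step-next x)) step≡In)
  ... | inj₁ (x-In , unheard) = inj₁ x-In , hears-even⁺ x x-In unheard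
  ... | inj₂ (x-Un , unheard₀ , unheard) =
    inj₂ (x-Un , λ y xy y-In → unheard₀ (hears-0⁺ pos x y (λ x-In → Un≢In (≡.trans (≡.sym x-Un) x-In)) xy y-In)) ,
    hears-odd⁺ x x-Un unheard
    where
    Un≢In : Un ≢ In
    Un≢In ()

  step-Out : Pos ℓ → ∀ x y → s x ≢ In → T (adj G x y) → s y ≡ In → step G s ℓ x ≡ Out
  step-Out pos x y x≢In xy y-In = ≡.trans (step-next x) (next-Out⁺ x≢In (hears-0⁺ pos x y x≢In xy y-In))

  step-≢Out : ∀ x → s x ≢ In → (∀ y → T (adj G x y) → s y ≢ In) → step G s ℓ x ≢ Out
  step-≢Out x x≢In no-In step≡Out =
    hears-0⁻ x no-In (next-Out⁻ x≢In (≡.trans (≡.sym (step-next x)) step≡Out))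

  -- A mixed pair is excluded because a `Un` candidate has no `In` neighbour. Adjacent candidates
  -- therefore compete with each other on the same kind of notes.
  adjacent-candidates : ∀ x y → T (adj G x y) → Candidate x → Candidate y → s y ≡ s x
  adjacent-candidates x y xy (inj₁ x-In)          (inj₁ y-In)          = ≡.trans y-In (≡.sym x-In)
  adjacent-candidates x y xy (inj₁ x-In)          (inj₂ (_ , no-In))   = ⊥-elim (no-In x (subst T (adj-sym G x y) xy) x-In)
  adjacent-candidates x y xy (inj₂ (_ , no-In))   (inj₁ y-In)          = ⊥-elim (no-In y xy y-In)
  adjacent-candidates x y xy (inj₂ (x-Un , _))    (inj₂ (y-Un , _))    = ≡.trans y-Un (≡.sym x-Un)

-- Elimination, and one round away from changes

InNoIn⁺ : ∀ (G : Graph n) s x → s x ≡ In → (∀ y → T (adj G x y) → s y ≢ In) → T (InNoIn G s x)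
InNoIn⁺ G s x x-In no-In = ∧⁺ (isIn⁺ x-In) (not⁺ λ h → let (y , xy∧In) = any-agent⁻ _ h
                                                           (xy , y-In) = ∧⁻ {adj G x y} xy∧In
                                                       in no-In y xy (isIn⁻ y-In))

InNoIn⁻ : ∀ (G : Graph n) s x → T (InNoIn G s x) → s x ≡ In × (∀ y → T (adj G x y) → s y ≢ In)
InNoIn⁻ G s x h with ∧⁻ {isIn (s x)} h
... | x-In , unheard = isIn⁻ x-In , λ y xy y-In → not⁻ unheard (any-agent⁺ _ y (∧⁺ xy (isIn⁺ y-In)))

closed : Graph n → Fin n → Fin n → Bool
closed G u x = ⌊ x ≟ u ⌋ ∨ adj G u x

closed⁻ : ∀ (G : Graph n) u x → T (closed G u x) → x ≡ u ⊎ T (adj G u x)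
closed⁻ G u x h with ∨⁻ {⌊ x ≟ u ⌋} h
... | inj₁ x≡u = inj₁ (toWitness x≡u)
... | inj₂ ux  = inj₂ ux

closed-self : ∀ (G : Graph n) u → T (closed G u u)
closed-self G u = ∨⁺ {⌊ u ≟ u ⌋} (inj₁ (fromWitness refl))

closed-adj : ∀ (G : Graph n) u x → T (adj G u x) → T (closed G u x)
closed-adj G u x ux = ∨⁺ {⌊ x ≟ u ⌋} (inj₂ ux)

eliminated⁺ : ∀ (G : Graph n) s u x → T (closed G u x) → T (InNoIn G s x) → T (eliminated G s u)
eliminated⁺ G s u x u~x x-InNoIn with closed⁻ G u x u~x
... | inj₁ refl = ∨⁺ (inj₁ x-InNoIn)
... | inj₂ ux   = ∨⁺ {InNoIn G s u} (inj₂ (any-agent⁺ _ x (∧⁺ ux x-InNoIn)))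

eliminated⁻ : ∀ (G : Graph n) s u → T (eliminated G s u) → ∃ λ x → T (closed G u x) × T (InNoIn G s x)
eliminated⁻ G s u h with ∨⁻ {InNoIn G s u} h
... | inj₁ u-InNoIn = u , closed-self G u , u-InNoIn
... | inj₂ nbr with any-agent⁻ _ nbr
...   | x , ux∧x with ∧⁻ {adj G u x} ux∧x
...     | ux , x-InNoIn = x , closed-adj G u x ux , x-InNoIn

module Round (Gp Gn : Graph n) (o : Fin n → Maybe St) (s : Fin n → St) where

  s′ : (Fin n → ℕ) → Fin n → St
  s′ ℓ = override o (step Gp s ℓ)

  Near : Fin n → Set
  Near u = T (nearChanged Gp Gn o u)

  record Unchanged (x : Fin n) : Set where
    field
      same-adj    : ∀ y → adj Gp x y ≡ adj Gn x y
      no-override : ∀ ℓ → s′ ℓ x ≡ step Gp s ℓ x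
  open Unchanged public

  Calm : Fin n → Set
  Calm x = Unchanged x × (∀ y → T (adj Gn x y) → Unchanged y)

  xor-false : ∀ {a b} → ¬ T (a xor b) → a ≡ b
  xor-false {true}  {true}  _ = refl
  xor-false {true}  {false} h = ⊥-elim (h tt)
  xor-false {false} {true}  h = ⊥-elim (h tt)
  xor-false {false} {false} _ = refl

  unchanged : ∀ x → ¬ T (changed Gp Gn o x) → Unchanged x
  unchanged x ¬ch .same-adj y = xor-false λ h → ¬ch (∨⁺ {is-just (o x)} (inj₂ (any-agent⁺ _ y h)))
  unchanged x ¬ch .no-override ℓ with o x
  ... | nothing = refl
  ... | just t  = ⊥-elim (¬ch tt)

  -- The radius 2 of `nearChanged` covers `u`, its neighbours and their neighbours, hence all
  -- neighbours of any `x` in the closed neighbourhood of `u`.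
  calm : ∀ u → ¬ Near u → ∀ x → T (closed Gn u x) → Calm x
  calm u ¬near x u~x with closed⁻ Gn u x u~x
  ... | inj₁ refl = unchanged u (λ ch → ¬near (∨⁺ (inj₁ ch))) ,
                    λ y uy → unchanged y λ ch → ¬near (∨⁺ {changed Gp Gn o u} (inj₂ (any-agent⁺ _ y (∧⁺ uy (∨⁺ (inj₁ ch))))))
  ... | inj₂ ux   = unchanged x (λ ch → ¬near (∨⁺ {changed Gp Gn o u} (inj₂ (any-agent⁺ _ x (∧⁺ ux (∨⁺ (inj₁ ch))))))) ,
                    λ y xy → unchanged y λ ch → ¬near (∨⁺ {changed Gp Gn o u} (inj₂ (any-agent⁺ _ x (∧⁺ ux
                               (∨⁺ {changed Gp Gn o x} (inj₂ (any-agent⁺ _ y (∧⁺ xy ch))))))))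

  calm-self : ∀ u → ¬ Near u → Calm u
  calm-self u ¬near = calm u ¬near u (closed-self Gn u)

  module _ (ℓ : Fin n → ℕ) (pos : Pos ℓ) where
    open Step Gp s ℓ

    In⁻ : ∀ x → Unchanged x → s′ ℓ x ≡ In → Candidate x × Unbeaten x
    In⁻ x un x-In = step-In⁻ pos x (≡.trans (≡.sym (no-override un ℓ)) x-In)

    In⁺ : ∀ x → Unchanged x → Candidate x → Unbeaten x → s′ ℓ x ≡ In
    In⁺ x un cand unbeaten = ≡.trans (no-override un ℓ) (step-In⁺ x cand unbeaten)

    -- If a neighbour also ended the round as `In`, it would be a candidate in the same state as `x`
    -- and unbeaten by `x`, contradicting the strict win of `x`.
    strict⇒InNoIn : ∀ x → Calm x → Candidate x → (∀ y → T (adj Gp x y) → s y ≡ s x → ℓ y ℕ.< ℓ x) →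
                    T (InNoIn Gn (s′ ℓ) x)
    strict⇒InNoIn x (un , un-nbr) cand strict = InNoIn⁺ Gn (s′ ℓ) x
      (In⁺ x un cand (λ y xy eq → ℕ.<⇒≤ (strict y xy eq)))
      λ y xy′ y-In → let xy = subst T (≡.sym (same-adj un y)) xy′
                         (y-cand , y-unbeaten) = In⁻ y (un-nbr y xy′) y-In
                         sy≡sx = adjacent-candidates x y xy cand y-cand
                     in ℕ.<⇒≱ (strict y xy sy≡sx) (y-unbeaten x (subst T (adj-sym Gp x y) xy) (≡.sym sy≡sx))

    -- Without `In` neighbours the strict win holds vacuously.
    InNoIn-persists : ∀ x → Calm x → T (InNoIn Gp s x) → T (InNoIn Gn (s′ ℓ) x)
    InNoIn-persists x c x-InNoIn with InNoIn⁻ Gp s x x-InNoIn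
    ... | x-In , no-In = strict⇒InNoIn x c (inj₁ x-In) λ y xy sy≡sx → ⊥-elim (no-In y xy (≡.trans sy≡sx x-In))

    -- The witness stays `In` without `In` neighbours, and its neighbours hear note 0 and are `Out`.
    -- The second component later shows that an agent still `Un` after two rounds was active at the
    -- start.
    eliminated-persists : ∀ u → ¬ Near u → T (eliminated Gp s u) → T (eliminated Gn (s′ ℓ) u) × s′ ℓ u ≢ Un
    eliminated-persists u ¬near elim with eliminated⁻ Gp s u elim
    ... | x , u~x , x-InNoIn with closed⁻ Gp u x u~x
    ...   | inj₁ refl = eliminated⁺ Gn (s′ ℓ) u u (closed-self Gn u) survives , In≢Un
      where
      survives = InNoIn-persists u (calm-self u ¬near) x-InNoIn
      In≢Un : s′ ℓ u ≢ Un
      In≢Un u-Un with ≡.trans (≡.sym u-Un) (proj₁ (InNoIn⁻ Gn (s′ ℓ) u survives))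
      ... | ()
    ...   | inj₂ ux = eliminated⁺ Gn (s′ ℓ) u x ux′ (InNoIn-persists x (calm u ¬near x ux′) x-InNoIn) , Out≢Un
      where
      un = proj₁ (calm-self u ¬near)
      ux′ = closed-adj Gn u x (subst T (same-adj un x) ux)
      Out≢Un : s′ ℓ u ≢ Un
      Out≢Un u-Un with InNoIn⁻ Gp s x x-InNoIn
      ... | x-In , no-In with ≡.trans (≡.sym u-Un) (≡.trans (no-override un ℓ)
                                (step-Out pos u x (no-In u (subst T (adj-sym Gp u x) ux)) ux x-In))
      ...   | ()

  -- An agent that is not `In` can become `Out` only by hearing note 0, that is, from an `In`
  -- neighbour.
  quiet⇒Un : ∀ ℓ u → ¬ Near u → (∀ x → T (closed Gp u x) → s x ≢ In) → s′ ℓ u ≢ In → s′ ℓ u ≡ Un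
  quiet⇒Un ℓ u ¬near no-In u≢In with s′ ℓ u in eq
  ... | In  = ⊥-elim (u≢In refl)
  ... | Un  = refl
  ... | Out = ⊥-elim (Step.step-≢Out Gp s ℓ u (no-In u (closed-self Gp u)) (λ y uy → no-In y (closed-adj Gp u y uy))
                (≡.trans (≡.sym (no-override (proj₁ (calm-self u ¬near)) ℓ)) eq))

  module _ (ℓ ℓ⁺ : Fin n → ℕ) (pos : Pos ℓ) (pos⁺ : Pos ℓ⁺) (x : Fin n)
           (raised : ℓ x ℕ.< ℓ⁺ x) (others : ∀ y → y ≢ x → ℓ⁺ y ≡ ℓ y) where
    open Step

    ℓ≤ℓ⁺ : ∀ y → ℓ y ℕ.≤ ℓ⁺ y
    ℓ≤ℓ⁺ y with y ≟ x
    ... | yes refl = ℕ.<⇒≤ raised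
    ... | no y≢x   = ℕ.≤-reflexive (≡.sym (others y y≢x))

    -- Raising the value of an unbeaten candidate breaks all its ties in its favour.
    raise-InNoIn : Calm x → s′ ℓ x ≡ In → T (InNoIn Gn (s′ ℓ⁺) x)
    raise-InNoIn c x-In with In⁻ ℓ pos x (proj₁ c) x-In
    ... | cand , unbeaten = strict⇒InNoIn ℓ⁺ pos⁺ x c cand λ y xy sy≡sx →
      ℕ.≤-<-trans (ℕ.≤-trans (ℕ.≤-reflexive (others y (λ { refl → subst T (adj-irrefl Gp x) xy }))) (unbeaten y xy sy≡sx)) raised

    -- A larger value at `x` can only hurt the other competitors, so no agent but `x` can newly
    -- become `In`.
    raise-In⁻ : ∀ y → y ≢ x → Unchanged y → s′ ℓ⁺ y ≡ In → s′ ℓ y ≡ In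
    raise-In⁻ y y≢x un y-In with In⁻ ℓ⁺ pos⁺ y un y-In
    ... | cand , unbeaten = In⁺ ℓ pos y un cand λ z yz sz≡sy →
      ℕ.≤-trans (ℓ≤ℓ⁺ z) (ℕ.≤-trans (unbeaten z yz sz≡sy) (ℕ.≤-reflexive (others y y≢x)))

-- Elimination by weak and strict winners

topped : ℕ → (Fin n → ℕ) → Bool
topped L ℓ = anyAgent (λ x → ℓ x ℕ.≡ᵇ suc L)

-- The events "x is the first weak winner in xs" are disjoint, and survive raising the value of x.
any-half : ∀ L (weak good : Fin n → (Fin n → ℕ) → Bool) →
           (∀ x ℓ → T (good x ℓ) → T (weak x ℓ)) →
           (∀ x ℓ → ℓ x ≡ suc L → T (weak x ℓ) → T (good x ℓ)) →
           (∀ x ℓ ℓ⁺ → Pos ℓ → Pos ℓ⁺ → ℓ x ℕ.< ℓ⁺ x → (∀ y → y ≢ x → ℓ⁺ y ≡ ℓ y) →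
              T (weak x ℓ) → T (good x ℓ⁺) × (∀ y → y ≢ x → T (weak y ℓ⁺) → T (weak y ℓ))) →
           ∀ xs → 𝔼 L (λ ℓ → ⟦ any (λ x → weak x ℓ) xs ⟧) ≤ 2ℚ * 𝔼 L (λ ℓ → ⟦ any (λ x → good x ℓ) xs ⟧)
any-half {n} L weak good good⇒weak top raise = go
  where
  W V : List (Fin n) → (Fin n → ℕ) → Bool
  W xs ℓ = any (λ x → weak x ℓ) xs
  V xs ℓ = any (λ x → good x ℓ) xs

  V⇒W : ∀ xs ℓ → T (V xs ℓ) → T (W xs ℓ)
  V⇒W xs ℓ h with find (any⁻ (λ x → good x ℓ) xs h)
  ... | x , x∈xs , gx = any⁺ (λ x → weak x ℓ) (lose x∈xs (good⇒weak x ℓ gx))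

  -- Both events exclude weak winners in `xs`. `newV` excludes `W` rather than `V`, because it is
  -- weak wins of other agents that cannot appear when `x` is raised.
  newW newV : Fin n → List (Fin n) → (Fin n → ℕ) → Bool
  newW x xs ℓ = weak x ℓ ∧ not (W xs ℓ)
  newV x xs ℓ = good x ℓ ∧ not (W xs ℓ)

  Pos-≔ : ∀ {ℓ : Fin n → ℕ} x k → Pos ℓ → Pos (ℓ [ x ≔ suc k ])
  Pos-≔ {ℓ} x k pos y with y ≟ x
  ... | yes refl = subst (1 ℕ.≤_) (≡.sym ([≔]-same ℓ x (suc k))) (s≤s z≤n)
  ... | no y≢x   = subst (1 ℕ.≤_) (≡.sym ([≔]-other ℓ x (suc k) y y≢x)) (pos y)

  shift : ∀ x xs ℓ → Pos ℓ → ∀ k → T (newW x xs (ℓ [ x ≔ suc k ])) → T (newV x xs (ℓ [ x ≔ suc (suc k) ]))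
  shift x xs ℓ pos k h =
    ∧⁺ (proj₁ raised) (not⁺ λ w⁺ → let (y , y∈xs , wy) = find (any⁻ (λ x → weak x ℓ⁺) xs w⁺) in back y y∈xs wy)
    where
    ℓ₁ ℓ⁺ : Fin n → ℕ
    ℓ₁ = ℓ [ x ≔ suc k ]
    ℓ⁺ = ℓ [ x ≔ suc (suc k) ]
    wx : T (weak x ℓ₁)
    wx = proj₁ (∧⁻ {weak x ℓ₁} h)
    no-W : ¬ T (W xs ℓ₁)
    no-W = not⁻ (proj₂ (∧⁻ {weak x ℓ₁} h))
    raised : T (good x ℓ⁺) × (∀ y → y ≢ x → T (weak y ℓ⁺) → T (weak y ℓ₁))
    raised = raise x ℓ₁ ℓ⁺ (Pos-≔ x k pos) (Pos-≔ x (suc k) pos)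
      (≡.subst₂ ℕ._<_ (≡.sym ([≔]-same ℓ x (suc k))) (≡.sym ([≔]-same ℓ x (suc (suc k)))) ℕ.≤-refl)
      (λ y y≢x → ≡.trans ([≔]-other ℓ x _ y y≢x) (≡.sym ([≔]-other ℓ x _ y y≢x)))
      wx
    back : ∀ y → y ∈ xs → T (weak y ℓ⁺) → ⊥
    back y y∈xs wy with y ≟ x
    -- If `x` itself occurs in `xs`, its weak win before raising already contradicts `no-W`.
    ... | yes refl = no-W (any⁺ (λ x → weak x ℓ₁) (lose y∈xs wx))
    ... | no y≢x   = no-W (any⁺ (λ x → weak x ℓ₁) (lose y∈xs (proj₂ raised y y≢x wy)))

  new-half : ∀ x xs → 𝔼 L (λ ℓ → ⟦ newW x xs ℓ ⟧) ≤ 2ℚ * 𝔼 L (λ ℓ → ⟦ newV x xs ℓ ⟧)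
  new-half x xs = begin
    𝔼 L (λ ℓ → ⟦ newW x xs ℓ ⟧)             ≤⟨ 𝔼-coordinate L x coordinate ⟩
    𝔼 L (λ ℓ → 2ℚ * ⟦ newV x xs ℓ ⟧)        ≡⟨ 𝔼-* L 2ℚ (λ ℓ → ⟦ newV x xs ℓ ⟧) ⟩
    2ℚ * 𝔼 L (λ ℓ → ⟦ newV x xs ℓ ⟧)        ∎
    where
    open ≤-Reasoning
    coordinate : ∀ ℓ → Pos ℓ → μ L (λ k → ⟦ newW x xs (ℓ [ x ≔ k ]) ⟧) ≤ μ L (λ k → 2ℚ * ⟦ newV x xs (ℓ [ x ≔ k ]) ⟧)
    coordinate ℓ pos = begin
      μ L g                     ≡⟨ +-identityˡ (μ L g) ⟨
      0ℚ + μ L g                ≤⟨ +-monoˡ-≤ (μ L g) 0≤⟦ newV x xs (ℓ [ x ≔ 1 ]) ⟧ ⟩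
      h 1 + μ L g               ≤⟨ μ-shift L {g} {h} (λ k → ⟦⟧-mono (shift x xs ℓ pos k)) (⟦⟧-mono at-top) ⟩
      2ℚ * μ L h                ≡⟨ μ-* L 2ℚ h ⟨
      μ L (λ k → 2ℚ * h k)      ∎
      where
      g h : ℕ → ℚ
      g k = ⟦ newW x xs (ℓ [ x ≔ k ]) ⟧
      h k = ⟦ newV x xs (ℓ [ x ≔ k ]) ⟧
      at-top : T (newW x xs (ℓ [ x ≔ suc L ])) → T (newV x xs (ℓ [ x ≔ suc L ]))
      at-top w = ∧⁺ (top x _ ([≔]-same ℓ x (suc L)) (proj₁ (∧⁻ {weak x (ℓ [ x ≔ suc L ])} w)))
                    (proj₂ (∧⁻ {weak x (ℓ [ x ≔ suc L ])} w))

  ∨-split : ∀ a b → ⟦ a ∨ b ⟧ ≤ ⟦ b ⟧ + ⟦ a ∧ not b ⟧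
  ∨-split true  true  = ≤-refl
  ∨-split true  false = ≤-refl
  ∨-split false true  = ≤-refl
  ∨-split false false = ≤-refl

  ∨-join : ∀ a b c → (T b → T c) → ⟦ b ⟧ + ⟦ a ∧ not c ⟧ ≤ ⟦ a ∨ b ⟧
  ∨-join true  true  true  b⇒c = ≤-refl
  ∨-join true  true  false b⇒c = ⊥-elim (b⇒c tt)
  ∨-join true  false true  b⇒c = 0≤1
  ∨-join true  false false b⇒c = ≤-refl
  ∨-join false true  c     b⇒c = ≤-refl
  ∨-join false false c     b⇒c = ≤-refl

  go : ∀ xs → 𝔼 L (λ ℓ → ⟦ W xs ℓ ⟧) ≤ 2ℚ * 𝔼 L (λ ℓ → ⟦ V xs ℓ ⟧)
  go []       = ≤-reflexive (≡.trans (𝔼-const {n} L 0ℚ) (≡.sym (≡.trans (cong (2ℚ *_) (𝔼-const {n} L 0ℚ)) (*-zeroʳ 2ℚ))))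
  go (x ∷ xs) = begin
    𝔼 L (λ ℓ → ⟦ W (x ∷ xs) ℓ ⟧)                                              ≤⟨ 𝔼-mono L (λ ℓ _ → ∨-split (weak x ℓ) (W xs ℓ)) ⟩
    𝔼 L (λ ℓ → ⟦ W xs ℓ ⟧ + ⟦ newW x xs ℓ ⟧)                                  ≡⟨ 𝔼-+ L (λ ℓ → ⟦ W xs ℓ ⟧) (λ ℓ → ⟦ newW x xs ℓ ⟧) ⟩
    𝔼 L (λ ℓ → ⟦ W xs ℓ ⟧) + 𝔼 L (λ ℓ → ⟦ newW x xs ℓ ⟧)                     ≤⟨ +-mono-≤ (go xs) (new-half x xs) ⟩
    2ℚ * 𝔼 L (λ ℓ → ⟦ V xs ℓ ⟧) + 2ℚ * 𝔼 L (λ ℓ → ⟦ newV x xs ℓ ⟧)           ≡⟨ *-distribˡ-+ 2ℚ (𝔼 L (λ ℓ → ⟦ V xs ℓ ⟧)) (𝔼 L (λ ℓ → ⟦ newV x xs ℓ ⟧)) ⟨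
    2ℚ * (𝔼 L (λ ℓ → ⟦ V xs ℓ ⟧) + 𝔼 L (λ ℓ → ⟦ newV x xs ℓ ⟧))              ≡⟨ cong (2ℚ *_) (𝔼-+ L (λ ℓ → ⟦ V xs ℓ ⟧) (λ ℓ → ⟦ newV x xs ℓ ⟧)) ⟨
    2ℚ * 𝔼 L (λ ℓ → ⟦ V xs ℓ ⟧ + ⟦ newV x xs ℓ ⟧)                             ≤⟨ *-monoˡ-≤ (nonNegative⁻¹ 2ℚ) (𝔼-mono L (λ ℓ _ → ∨-join (good x ℓ) (V xs ℓ) (W xs ℓ) (V⇒W xs ℓ))) ⟩
    2ℚ * 𝔼 L (λ ℓ → ⟦ V (x ∷ xs) ℓ ⟧)                                         ∎
    where open ≤-Reasoning

nearIn : Graph n → (Fin n → St) → Fin n → Fin n → Bool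
nearIn G s u v = anyAgent (λ x → (closed G u x ∨ closed G v x) ∧ isIn (s x))

nearIn⁺ : ∀ (G : Graph n) s u v x → T (closed G u x ∨ closed G v x) → s x ≡ In → T (nearIn G s u v)
nearIn⁺ G s u v x x~ x-In = any-agent⁺ _ x (∧⁺ x~ (isIn⁺ x-In))

module _ (Gp Gn : Graph n) (o : Fin n → Maybe St) (s : Fin n → St) where
  open Round Gp Gn o s

  settled : ℕ → Fin n → Fin n → (Fin n → ℕ) → Bool
  settled L u v ℓ = (eliminated Gn (s′ ℓ) u ∨ eliminated Gn (s′ ℓ) v) ∨ topped L ℓ

  -- Given some `In` agent in the two closed neighbourhoods, the edge is settled with conditional
  -- probability at least ½: `any-half` applied to the agents of these neighbourhoods.
  nearIn-half : ∀ L u v → ¬ Near u → ¬ Near v →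
                𝔼 L (λ ℓ → ⟦ nearIn Gn (s′ ℓ) u v ⟧) ≤ 2ℚ * 𝔼 L (λ ℓ → ⟦ nearIn Gn (s′ ℓ) u v ∧ settled L u v ℓ ⟧)
  nearIn-half L u v ¬nu ¬nv = ≤-trans (any-half L weak good (λ x ℓ g → proj₁ (∧⁻ {weak x ℓ} g)) top raise (allFin n))
    (*-monoˡ-≤ (nonNegative⁻¹ 2ℚ) (𝔼-mono L (λ ℓ _ → ⟦⟧-mono (settles ℓ))))
    where
    ball : Fin n → Bool
    ball x = closed Gn u x ∨ closed Gn v x
    weak good : Fin n → (Fin n → ℕ) → Bool
    weak x ℓ = ball x ∧ isIn (s′ ℓ x)
    -- Keeping the conjunct `weak` preserves `nearIn` in the conclusion, which later makes the
    -- successes of two successive rounds disjoint.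
    good x ℓ = weak x ℓ ∧ (InNoIn Gn (s′ ℓ) x ∨ (ℓ x ℕ.≡ᵇ suc L))
    ball-calm : ∀ x → T (ball x) → Calm x
    ball-calm x b = [ calm u ¬nu x , calm v ¬nv x ]′ (∨⁻ b)
    top : ∀ x ℓ → ℓ x ≡ suc L → T (weak x ℓ) → T (good x ℓ)
    top x ℓ ℓx w = ∧⁺ w (∨⁺ {InNoIn Gn (s′ ℓ) x} (inj₂ (ℕ.≡⇒≡ᵇ (ℓ x) (suc L) ℓx)))
    raise : ∀ x ℓ ℓ⁺ → Pos ℓ → Pos ℓ⁺ → ℓ x ℕ.< ℓ⁺ x → (∀ y → y ≢ x → ℓ⁺ y ≡ ℓ y) →
            T (weak x ℓ) → T (good x ℓ⁺) × (∀ y → y ≢ x → T (weak y ℓ⁺) → T (weak y ℓ))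
    raise x ℓ ℓ⁺ pos pos⁺ raised others w =
      ∧⁺ (∧⁺ bx (isIn⁺ (proj₁ (InNoIn⁻ Gn (s′ ℓ⁺) x strict)))) (∨⁺ (inj₁ strict)) ,
      λ y y≢x wy → let (by , y-In) = ∧⁻ {ball y} wy in
        ∧⁺ by (isIn⁺ (raise-In⁻ ℓ ℓ⁺ pos pos⁺ x raised others y y≢x (proj₁ (ball-calm y by)) (isIn⁻ y-In)))
      where
      bx : T (ball x)
      bx = proj₁ (∧⁻ {ball x} w)
      strict : T (InNoIn Gn (s′ ℓ⁺) x)
      strict = raise-InNoIn ℓ ℓ⁺ pos pos⁺ x raised others (ball-calm x bx) (isIn⁻ (proj₂ (∧⁻ {ball x} w)))
    settles : ∀ ℓ → T (anyAgent (λ x → good x ℓ)) → T (nearIn Gn (s′ ℓ) u v ∧ settled L u v ℓ)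
    settles ℓ h with any-agent⁻ _ h
    ... | x , gx with ∧⁻ {weak x ℓ} gx
    ...   | wx , strict∨top with ∧⁻ {ball x} wx
    ...     | bx , x-In = ∧⁺ (nearIn⁺ Gn (s′ ℓ) u v x bx (isIn⁻ x-In)) (settle (∨⁻ {InNoIn Gn (s′ ℓ) x} strict∨top) (∨⁻ {closed Gn u x} bx))
      where
      settle : T (InNoIn Gn (s′ ℓ) x) ⊎ T (ℓ x ℕ.≡ᵇ suc L) → T (closed Gn u x) ⊎ T (closed Gn v x) → T (settled L u v ℓ)
      settle (inj₁ strict) (inj₁ u~x) = ∨⁺ (inj₁ (∨⁺ (inj₁ (eliminated⁺ Gn (s′ ℓ) u x u~x strict))))
      settle (inj₁ strict) (inj₂ v~x) = ∨⁺ (inj₁ (∨⁺ {eliminated Gn (s′ ℓ) u} (inj₂ (eliminated⁺ Gn (s′ ℓ) v x v~x strict))))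
      settle (inj₂ at-top) _ = ∨⁺ {eliminated Gn (s′ ℓ) u ∨ eliminated Gn (s′ ℓ) v} (inj₂ (any-agent⁺ _ x at-top))

-- Winning against the neighbours of both ends

module _ (a : Fin n → Fin n → Bool) where

  -- Exceeding the neighbours of `v` lets `v` win its round; exceeding those of `u` makes the winner
  -- unique for fixed `u`.
  beats : Fin n → Fin n → (Fin n → ℕ) → Bool
  beats u v ℓ = conj (λ x → ⌊ x ≟ v ⌋ ∨ (not (a u x ∨ a v x) ∨ (ℓ x ℕ.<ᵇ ℓ v)))

  beats⁻ : ∀ u v ℓ x → T (beats u v ℓ) → x ≢ v → T (a u x ∨ a v x) → ℓ x ℕ.< ℓ v
  beats⁻ u v ℓ x h x≢v rival with ∨⁻ {⌊ x ≟ v ⌋} (conj⁻ _ h x)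
  ... | inj₁ x≡v = ⊥-elim (x≢v (toWitness x≡v))
  ... | inj₂ h′ with ∨⁻ {not (a u x ∨ a v x)} h′
  ...   | inj₁ ¬rival = ⊥-elim (not⁻ ¬rival rival)
  ...   | inj₂ <      = ℕ.<ᵇ⇒< (ℓ x) (ℓ v) <

  count : Bool → ℕ
  count b = if b then 1 else 0

  deg : Fin n → ℕ
  deg u = total (λ x → count (a u x))

  -- Split by the value of `v`, and use independence for the rivals to be smaller. The exponent is
  -- the degree sum less one, as `v` itself is counted once, among the neighbours of `u`.
  beats-probability : ∀ L u v j → T (a u v) → a v v ≡ false → deg u ℕ.+ deg v ≡ suc j →
                      strictMax L j ≤ 𝔼 L (λ ℓ → ⟦ beats u v ℓ ⟧)
  beats-probability L u v j auv avv degs = begin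
    strictMax L j                                                          ≤⟨ sum-mono {L} term ⟩
    sum {L} (λ k → 𝔼 L (λ ℓ → ⟦ conj (λ x → b k x (ℓ x)) ⟧))              ≡⟨ 𝔼-sum L (λ (k : Fin L) ℓ → ⟦ conj (λ x → b k x (ℓ x)) ⟧) ⟨
    𝔼 L (λ ℓ → sum {L} (λ k → ⟦ conj (λ x → b k x (ℓ x)) ⟧))              ≤⟨ 𝔼-mono L (λ ℓ _ → sum-unique (λ k → wins k ℓ) (unique ℓ)) ⟩
    𝔼 L (λ ℓ → ⟦ beats u v ℓ ⟧)                                           ∎
    where
    open ≤-Reasoning
    e : Fin n → ℕ
    e x = count (a u x) ℕ.+ count (a v x)
    b : Fin L → Fin n → ℕ → Bool
    -- The event with index `k` asks for the value `k + 2` at `v` and at most `k + 1` at each rival;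
    -- `k < L` covers the values from 2 to the cap.
    b k x y = if ⌊ x ≟ v ⌋ then (y ℕ.≡ᵇ suc (suc (toℕ k))) else (not (a u x ∨ a v x) ∨ (y ℕ.≤ᵇ suc (toℕ k)))
    ev≡1 : e v ≡ 1
    ev≡1 rewrite avv with true ← a u v = refl
    rest : totalExcept v e ≡ j
    rest = ℕ.suc-injective (≡.trans (≡.trans (cong (ℕ._+ totalExcept v e) (≡.sym ev≡1)) (≡.sym (total-split v e)))
             (≡.trans (total-+ (λ x → count (a u x)) (λ x → count (a v x))) degs))
    at-v : ∀ (k : Fin L) → ½^ (suc (suc (toℕ k))) ≤ μ L (λ y → ⟦ b k v y ⟧)
    at-v k with v ≟ v
    ... | yes _  = ½^≤μ L (suc (toℕ k)) (toℕ<n k)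
    ... | no v≢v = ⊥-elim (v≢v refl)
    below : ∀ k x → x ≢ v → cdf (suc (toℕ k)) ^ e x ≤ μ L (λ y → ⟦ b k x y ⟧)
    below k x x≢v with x ≟ v
    ... | yes x≡v = ⊥-elim (x≢v x≡v)
    ... | no _ with a u x | a v x
    ...   | false | false = ≤-reflexive (≡.sym (μ-const L 1ℚ))
    ...   | false | true  = ≤-trans (≤-reflexive (*-identityʳ c)) (cdf≤μ L (suc (toℕ k)))
      where c = cdf (suc (toℕ k))
    ...   | true  | false = ≤-trans (≤-reflexive (*-identityʳ c)) (cdf≤μ L (suc (toℕ k)))
      where c = cdf (suc (toℕ k))
    -- A common neighbour is counted twice in `e`; as `cdf` is at most 1, its square is still a
    -- lower bound.
    ...   | true  | true  = ≤-trans (≤-trans (*-monoˡ-≤ (0≤cdf (suc (toℕ k))) (≤-trans (≤-reflexive (*-identityʳ c)) (cdf≤1 (suc (toℕ k))))) (≤-reflexive (*-identityʳ c))) (cdf≤μ L (suc (toℕ k)))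
      where c = cdf (suc (toℕ k))
    term : ∀ (k : Fin L) → ½^ (suc (suc (toℕ k))) * cdf (suc (toℕ k)) ^ j ≤ 𝔼 L (λ ℓ → ⟦ conj (λ x → b k x (ℓ x)) ⟧)
    term k = begin
      ½^ (suc (suc (toℕ k))) * cdf (suc (toℕ k)) ^ j                       ≡⟨ cong (λ m → ½^ (suc (suc (toℕ k))) * cdf (suc (toℕ k)) ^ m) rest ⟨
      ½^ (suc (suc (toℕ k))) * cdf (suc (toℕ k)) ^ totalExcept v e         ≤⟨ prod-≥ (0≤cdf (suc (toℕ k))) (0≤½^ (suc (suc (toℕ k)))) v _ e (at-v k) (below k) ⟩
      prod (λ x → μ L (λ y → ⟦ b k x y ⟧))                                 ≡⟨ 𝔼-independent L (b k) ⟨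
      𝔼 L (λ ℓ → ⟦ conj (λ x → b k x (ℓ x)) ⟧)                            ∎
    value : ∀ k ℓ → T (conj (λ x → b k x (ℓ x))) → ℓ v ≡ suc (suc (toℕ k))
    value k ℓ h with v ≟ v | conj⁻ (λ x → b k x (ℓ x)) h v
    ... | yes _  | eq = ℕ.≡ᵇ⇒≡ (ℓ v) _ eq
    ... | no v≢v | _  = ⊥-elim (v≢v refl)
    wins : ∀ k ℓ → T (conj (λ x → b k x (ℓ x))) → T (beats u v ℓ)
    wins k ℓ h = conj⁺ _ wins-x
      where
      wins-x : ∀ x → T (⌊ x ≟ v ⌋ ∨ (not (a u x ∨ a v x) ∨ (ℓ x ℕ.<ᵇ ℓ v)))
      wins-x x with x ≟ v | conj⁻ (λ x → b k x (ℓ x)) h x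
      ... | yes _ | _ = tt
      ... | no _  | h′ with ∨⁻ {not (a u x ∨ a v x)} h′
      ...   | inj₁ ¬rival = ∨⁺ (inj₁ ¬rival)
      ...   | inj₂ le     = ∨⁺ {not (a u x ∨ a v x)} (inj₂ (ℕ.<⇒<ᵇ
                (subst (ℓ x ℕ.<_) (≡.sym (value k ℓ h)) (s≤s (ℕ.≤ᵇ⇒≤ (ℓ x) _ le)))))
    unique : ∀ ℓ k k′ → T (conj (λ x → b k x (ℓ x))) → T (conj (λ x → b k′ x (ℓ x))) → k ≡ k′
    unique ℓ k k′ h h′ = toℕ-injective (ℕ.suc-injective (ℕ.suc-injective (≡.trans (≡.sym (value k ℓ h)) (value k′ ℓ h′))))

-- Charging removed edges to winners

0≤2 : 0ℚ ≤ 2ℚ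
0≤2 = nonNegative⁻¹ 2ℚ

5ℚ : ℚ
5ℚ = ℤ.+ 5 / 1

ℕtoℚ-total : (b : Fin n → Bool) → ℕtoℚ (total (λ x → if b x then 1 else 0)) ≡ sum (λ x → ⟦ b x ⟧)
ℕtoℚ-total {zero}  b = refl
ℕtoℚ-total {suc n} b with b zero
... | true  = ≡.trans (ℕtoℚ-+ 1 (total (λ x → if b (suc x) then 1 else 0))) (cong (1ℚ +_) (ℕtoℚ-total (b ∘ suc)))
... | false = ≡.trans (ℕtoℚ-total (b ∘ suc)) (≡.sym (+-identityˡ _))

total-count≤ : (b : Fin n → Bool) → total (λ x → if b x then 1 else 0) ℕ.≤ n
total-count≤ {zero}  b = z≤n
total-count≤ {suc n} b with b zero
... | true  = s≤s (total-count≤ (b ∘ suc))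
... | false = ℕ.m≤n⇒m≤1+n (total-count≤ (b ∘ suc))

∑∑-mono : {f g : Fin n → Fin n → ℚ} → (∀ u v → f u v ≤ g u v) → ∑∑ f ≤ ∑∑ g
∑∑-mono f≤g = sum-mono (λ u → sum-mono (f≤g u))

∑∑-cong : {f g : Fin n → Fin n → ℚ} → (∀ u v → f u v ≡ g u v) → ∑∑ f ≡ ∑∑ g
∑∑-cong {n} f≡g = sum-cong-≗ {n} (λ u → sum-cong-≗ {n} (f≡g u))

∑∑-+ : (f g : Fin n → Fin n → ℚ) → ∑∑ (λ u v → f u v + g u v) ≡ ∑∑ f + ∑∑ g
∑∑-+ {n} f g = ≡.trans (sum-cong-≗ {n} (λ u → ∑-distrib-+ (f u) (g u))) (∑-distrib-+ (λ u → sum (f u)) (λ u → sum (g u)))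

∑∑-* : ∀ c (f : Fin n → Fin n → ℚ) → ∑∑ (λ u v → c * f u v) ≡ c * ∑∑ f
∑∑-* {n} c f = ≡.sym (≡.trans (*-distribˡ-sum c (λ u → sum (f u))) (sum-cong-≗ {n} (λ u → *-distribˡ-sum c (f u))))

𝔼-∑∑ : ∀ L (f : Fin n → Fin n → (Fin n → ℕ) → ℚ) → 𝔼 L (λ ℓ → ∑∑ (λ u v → f u v ℓ)) ≡ ∑∑ (λ u v → 𝔼 L (f u v))
𝔼-∑∑ {n} L f = ≡.trans (𝔼-sum L (λ u ℓ → sum (λ v → f u v ℓ))) (sum-cong-≗ {n} (λ u → 𝔼-sum L (f u)))

-- Métivier's edge count: a is the competition graph, p the set of fair pairs, r the set of eliminated ones.
module _ (a p : Fin n → Fin n → Bool) (r : (Fin n → ℕ) → Fin n → Fin n → Bool)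
         (a-irrefl : ∀ v → a v v ≡ false) (p⇒a : ∀ u v → T (p u v) → T (a u v))
         (p-sym : ∀ u v → T (p u v) → T (p v u))
         (removes : ∀ ℓ → Pos ℓ → ∀ u v x → T (p u v) → T (beats a u v ℓ) → T (a u x) → T (r ℓ u x))
         where

  -- Each fair pair yields expected weight 2/5, shared by its two orientations, and the weight of
  -- all wins at `u` is paid by the removed pairs at `u`. Summing both orientations doubles the
  -- payment, so 2/5 of the pairs cost at most `2ℚ * R`.
  pairs≤removed : ∀ {L} → 3 ℕ.+ (n ℕ.+ n) ℕ.≤ L → ∑∑ (λ u v → ⟦ p u v ⟧) ≤ 5ℚ * 𝔼 L (λ ℓ → ∑∑ (λ u x → ⟦ r ℓ u x ⟧))
  pairs≤removed {L} large = begin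
    P                                ≡⟨ solve 1 (λ x → x := con (ℤ.+ 5 / 2) :* (con ⅖ :* x)) refl P ⟩
    (ℤ.+ 5 / 2) * (⅖ * P)            ≤⟨ *-monoˡ-≤ (nonNegative⁻¹ (ℤ.+ 5 / 2)) ⅖P≤2R ⟩
    (ℤ.+ 5 / 2) * (2ℚ * R)           ≡⟨ solve 1 (λ x → con (ℤ.+ 5 / 2) :* (con 2ℚ :* x) := con 5ℚ :* x) refl R ⟩
    5ℚ * R                           ∎
    where
    open ≤-Reasoning
    P R : ℚ
    P = ∑∑ (λ u v → ⟦ p u v ⟧)
    R = 𝔼 L (λ ℓ → ∑∑ (λ u x → ⟦ r ℓ u x ⟧))
    D : Fin n → ℚ
    D u = ℕtoℚ (deg a u)
    w : Fin n → Fin n → (Fin n → ℕ) → Bool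
    w u v ℓ = p u v ∧ beats a u v ℓ
    f : Fin n → Fin n → ℚ
    f u v = D u * 𝔼 L (λ ℓ → ⟦ w u v ℓ ⟧)
    0≤f : ∀ u v → 0ℚ ≤ f u v
    0≤f u v = 0≤* (0≤ℕtoℚ (deg a u)) (0≤𝔼 L (λ ℓ _ → 0≤⟦ w u v ℓ ⟧))

    -- Both directions have the same probability bound q ≥ ⅖ / (deg u + deg v), so weighting v's win by deg u and
    -- u's win by deg v gives ⅖ per edge.
    edge : ∀ u v → ⅖ * ⟦ p u v ⟧ ≤ f u v + f v u
    edge u v with p u v in puv
    ... | false = ≤-trans (≤-reflexive (*-zeroʳ ⅖)) (0≤+ (0≤* (0≤ℕtoℚ (deg a u)) (≤-reflexive (≡.sym (𝔼-const {n} L 0ℚ)))) (0≤f v u))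
    ... | true  = begin
      ⅖ * 1ℚ                                                                    ≡⟨ *-identityʳ ⅖ ⟩
      ⅖                                                                         ≤⟨ strictMax-bound L j (ℕ.≤-trans (ℕ.+-monoʳ-≤ 3 suc-j≤) large) ⟩
      ℕtoℚ (suc j) * q                                                          ≡⟨ cong (λ m → ℕtoℚ m * q) degs ⟨
      ℕtoℚ (deg a u ℕ.+ deg a v) * q                                            ≡⟨ cong (_* q) (ℕtoℚ-+ (deg a u) (deg a v)) ⟩
      (D u + D v) * q                                                           ≡⟨ *-distribʳ-+ q (D u) (D v) ⟩
      D u * q + D v * q                                                         ≤⟨ +-mono-≤ (*-monoˡ-≤ (0≤ℕtoℚ (deg a u)) (beats-probability a L u v j Tauv (a-irrefl v) degs))
                                                                                            (*-monoˡ-≤ (0≤ℕtoℚ (deg a v)) q≤vu) ⟩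
      D u * 𝔼 L (λ ℓ → ⟦ beats a u v ℓ ⟧) + f v u                              ∎
      where
      Tpuv : T (p u v)
      Tpuv = subst T (≡.sym puv) tt
      Tauv : T (a u v)
      Tauv = p⇒a u v Tpuv
      j = totalExcept v (λ x → count a (a u x)) ℕ.+ deg a v
      degs : deg a u ℕ.+ deg a v ≡ suc j
      degs = cong (ℕ._+ deg a v) (≡.trans (total-split v (λ x → count a (a u x)))
               (cong (ℕ._+ totalExcept v (λ x → count a (a u x))) auv≡1))
        where
        auv≡1 : count a (a u v) ≡ 1
        auv≡1 with true ← a u v | _ ← Tauv = refl
      suc-j≤ : suc j ℕ.≤ n ℕ.+ n
      suc-j≤ = subst (ℕ._≤ n ℕ.+ n) degs (ℕ.+-mono-≤ (total-count≤ (a u)) (total-count≤ (a v)))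
      q = strictMax L j
      q≤vu : q ≤ 𝔼 L (λ ℓ → ⟦ w v u ℓ ⟧)
      q≤vu = ≤-trans (beats-probability a L v u j (p⇒a v u (p-sym u v Tpuv)) (a-irrefl u) (≡.trans (ℕ.+-comm (deg a v) (deg a u)) degs))
               (𝔼-mono L (λ ℓ _ → ⟦⟧-mono {beats a v u ℓ} {w v u ℓ} (∧⁺ (p-sym u v Tpuv))))

    -- Two winners at `u` would be rivals of each other and each would have to be larger. The single
    -- winner removes all `a`-pairs at `u`, whose number is its weight `D u`.
    vertex : ∀ ℓ → Pos ℓ → ∀ u → sum (λ v → D u * ⟦ w u v ℓ ⟧) ≤ sum (λ x → ⟦ r ℓ u x ⟧)
    vertex ℓ pos u = begin
      sum (λ v → D u * ⟦ w u v ℓ ⟧)               ≡⟨ *-distribˡ-sum (D u) (λ v → ⟦ w u v ℓ ⟧) ⟨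
      D u * sum (λ v → ⟦ w u v ℓ ⟧)               ≤⟨ *-monoˡ-≤ (0≤ℕtoℚ (deg a u)) (sum-unique (λ v → any-agent⁺ (λ v → w u v ℓ) v) unique) ⟩
      D u * ⟦ anyAgent (λ v → w u v ℓ) ⟧          ≤⟨ eliminated-or-not ⟩
      sum (λ x → ⟦ r ℓ u x ⟧)                     ∎
      where
      unique : ∀ v v′ → T (w u v ℓ) → T (w u v′ ℓ) → v ≡ v′
      unique v v′ h h′ with v ≟ v′
      ... | yes v≡v′ = v≡v′
      ... | no v≢v′ with ∧⁻ {p u v} h | ∧⁻ {p u v′} h′
      ...   | puv , b | puv′ , b′ = ⊥-elim (ℕ.<-asym
                (beats⁻ a u v ℓ v′ b (v≢v′ ∘ ≡.sym) (∨⁺ (inj₁ (p⇒a u v′ puv′))))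
                (beats⁻ a u v′ ℓ v b′ v≢v′ (∨⁺ (inj₁ (p⇒a u v puv)))))
      eliminated-or-not : D u * ⟦ anyAgent (λ v → w u v ℓ) ⟧ ≤ sum (λ x → ⟦ r ℓ u x ⟧)
      eliminated-or-not with anyAgent (λ v → w u v ℓ) in beaten
      ... | false = ≤-trans (≤-reflexive (*-zeroʳ (D u))) (0≤sum (λ x → 0≤⟦ r ℓ u x ⟧))
      ... | true with any-agent⁻ (λ v → w u v ℓ) (subst T (≡.sym beaten) tt)
      ...   | v , h = begin
        D u * 1ℚ                      ≡⟨ *-identityʳ (D u) ⟩
        D u                           ≡⟨ ℕtoℚ-total (a u) ⟩
        sum (λ x → ⟦ a u x ⟧)         ≤⟨ sum-mono (λ x → ⟦⟧-mono (removes ℓ pos u v x (proj₁ (∧⁻ {p u v} h)) (proj₂ (∧⁻ {p u v} h)))) ⟩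
        sum (λ x → ⟦ r ℓ u x ⟧)       ∎

    ⅖P≤2R : ⅖ * P ≤ 2ℚ * R
    ⅖P≤2R = begin
      ⅖ * P                                              ≡⟨ ∑∑-* ⅖ (λ u v → ⟦ p u v ⟧) ⟨
      ∑∑ (λ u v → ⅖ * ⟦ p u v ⟧)                         ≤⟨ ∑∑-mono edge ⟩
      ∑∑ (λ u v → f u v + f v u)                         ≡⟨ ∑∑-+ f (λ u v → f v u) ⟩
      ∑∑ f + ∑∑ (λ u v → f v u)                          ≡⟨ cong (∑∑ f +_) (∑-comm (λ u v → f v u)) ⟩
      ∑∑ f + ∑∑ f                                        ≡⟨ solve 1 (λ x → x :+ x := con 2ℚ :* x) refl (∑∑ f) ⟩
      2ℚ * ∑∑ f                                          ≡⟨ cong (2ℚ *_) (∑∑-cong (λ u v → 𝔼-* L (D u) (λ ℓ → ⟦ w u v ℓ ⟧))) ⟨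
      2ℚ * ∑∑ (λ u v → 𝔼 L (λ ℓ → D u * ⟦ w u v ℓ ⟧))   ≡⟨ cong (2ℚ *_) (𝔼-∑∑ L (λ u v ℓ → D u * ⟦ w u v ℓ ⟧)) ⟨
      2ℚ * 𝔼 L (λ ℓ → ∑∑ (λ u v → D u * ⟦ w u v ℓ ⟧))   ≤⟨ *-monoˡ-≤ 0≤2 (𝔼-mono L (λ ℓ pos → sum-mono (vertex ℓ pos))) ⟩
      2ℚ * R                                             ∎

isUn : St → Bool
isUn Un = true
isUn _  = false

isUn⁺ : ∀ {x} → x ≡ Un → T (isUn x)
isUn⁺ refl = tt

isUn⁻ : ∀ {x} → T (isUn x) → x ≡ Un
isUn⁻ {Un} _ = refl

nearIn-sym : ∀ (G : Graph n) s u v → T (nearIn G s u v) → T (nearIn G s v u)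
nearIn-sym G s u v h with any-agent⁻ _ h
... | x , x~∧In with ∧⁻ {closed G u x ∨ closed G v x} x~∧In
...   | x~ , x-In = nearIn⁺ G s v u x (subst T (∨-comm (closed G u x) (closed G v x)) x~) (isIn⁻ x-In)

-- Three rounds

module Main (n : ℕ) (G₀ : Graph n) (s₀ : Fin n → St)
            (G₁ : Graph n) (o₁ : Fin n → Maybe St)
            (G₂ : Graph n) (o₂ : Fin n → Maybe St)
            (G₃ : Graph n) (o₃ : Fin n → Maybe St) (N : ℕ) where

  Assign : Set
  Assign = Fin n → ℕ

  -- At least `N`, so that the truncation box stays below the cap, and large enough for
  -- `strictMax-bound`, since the degrees of two agents add up to at most `n + n`.
  L : ℕ
  L = N ℕ.+ (3 ℕ.+ (n ℕ.+ n))

  s₁ : Assign → Fin n → St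
  s₁ ℓ₀ = override o₁ (step G₀ s₀ ℓ₀)

  s₂ : Assign → Assign → Fin n → St
  s₂ ℓ₀ ℓ₁ = override o₂ (step G₁ (s₁ ℓ₀) ℓ₁)

  s₃ : Assign → Assign → Assign → Fin n → St
  s₃ = state3 G₀ s₀ G₁ o₁ G₂ o₂ G₃ o₃

  E₃ : (Assign → Assign → Assign → ℚ) → ℚ
  E₃ f = 𝔼 L (λ ℓ₀ → 𝔼 L (λ ℓ₁ → 𝔼 L (f ℓ₀ ℓ₁)))

  near₁ near₂ near₃ stable : Fin n → Bool
  near₁ = nearChanged G₀ G₁ o₁
  near₂ = nearChanged G₁ G₂ o₂
  near₃ = nearChanged G₂ G₃ o₃
  stable u = not (near₁ u) ∧ not (near₂ u) ∧ not (near₃ u)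

  stable⁻ : ∀ {u} → T (stable u) → ¬ T (near₁ u) × ¬ T (near₂ u) × ¬ T (near₃ u)
  stable⁻ {u} h with ∧⁻ {not (near₁ u)} h
  ... | ¬n₁ , h′ with ∧⁻ {not (near₂ u)} h′
  ...   | ¬n₂ , ¬n₃ = not⁻ ¬n₁ , not⁻ ¬n₂ , not⁻ ¬n₃

  activePair : Graph n → (Fin n → St) → Fin n → Fin n → Bool
  activePair G s u v = adj G u v ∧ active G s u ∧ active G s v

  -- `D` holds the initially active pairs to which the static dynamics apply in all three rounds;
  -- `A` holds the affected pairs.
  A D : Fin n → Fin n → Bool
  A u v = affected G₀ G₁ o₁ u v ∨ affected G₁ G₂ o₂ u v ∨ affected G₂ G₃ o₃ u v
  D u v = activePair G₀ s₀ u v ∧ stable u ∧ stable v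

  untopped : Assign → Assign → Assign → Bool
  untopped ℓ₀ ℓ₁ ℓ₂ = not (topped L ℓ₀) ∧ not (topped L ℓ₁) ∧ not (topped L ℓ₂)

  -- An assignment reaching the cap counts as removing everything. `removed` also ranges over `A`,
  -- because a winner of the last round may earn part of its payment on affected edges.
  survives removed : Assign → Assign → Assign → Fin n → Fin n → Bool
  survives ℓ₀ ℓ₁ ℓ₂ u v = activePair G₃ (s₃ ℓ₀ ℓ₁ ℓ₂) u v ∧ untopped ℓ₀ ℓ₁ ℓ₂
  removed ℓ₀ ℓ₁ ℓ₂ u v = (D u v ∨ A u v) ∧ not (survives ℓ₀ ℓ₁ ℓ₂ u v)

  same-adj₁ : ∀ u v → ¬ T (near₁ u) → adj G₀ u v ≡ adj G₁ u v
  same-adj₁ u v ¬n = Round.same-adj (proj₁ (Round.calm-self G₀ G₁ o₁ s₀ u ¬n)) v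

  same-adj₂ : ∀ u v → ¬ T (near₂ u) → adj G₁ u v ≡ adj G₂ u v
  -- `s₀` merely fills the state argument of `Round`, here and for the next round; the adjacency
  -- statement concerns the graphs.
  same-adj₂ u v ¬n = Round.same-adj (proj₁ (Round.calm-self G₁ G₂ o₂ s₀ u ¬n)) v

  same-adj₃ : ∀ u v → ¬ T (near₃ u) → adj G₂ u v ≡ adj G₃ u v
  same-adj₃ u v ¬n = Round.same-adj (proj₁ (Round.calm-self G₂ G₃ o₃ s₀ u ¬n)) v

  -- Traced backwards, because `affected` speaks of edges of the newer graph: being unaffected in a
  -- round shows that the edge was present one round earlier.
  unaffected : ∀ u v → T (adj G₃ u v) → ¬ T (A u v) → T (adj G₀ u v) × T (stable u) × T (stable v)
  unaffected u v uv₃ ¬A = uv₀ , ∧⁺ (not⁺ (¬n₁ ∘ inj₁)) (∧⁺ (not⁺ (¬n₂ ∘ inj₁)) (not⁺ (¬n₃ ∘ inj₁))) ,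
                                ∧⁺ (not⁺ (¬n₁ ∘ inj₂)) (∧⁺ (not⁺ (¬n₂ ∘ inj₂)) (not⁺ (¬n₃ ∘ inj₂)))
    where
    ¬n₃ : ¬ (T (near₃ u) ⊎ T (near₃ v))
    ¬n₃ h = ¬A (∨⁺ {affected G₀ G₁ o₁ u v} (inj₂ (∨⁺ {affected G₁ G₂ o₂ u v} (inj₂ (∧⁺ uv₃ (∨⁺ h))))))
    uv₂ : T (adj G₂ u v)
    uv₂ = subst T (≡.sym (same-adj₃ u v (¬n₃ ∘ inj₁))) uv₃
    ¬n₂ : ¬ (T (near₂ u) ⊎ T (near₂ v))
    ¬n₂ h = ¬A (∨⁺ {affected G₀ G₁ o₁ u v} (inj₂ (∨⁺ (inj₁ (∧⁺ uv₂ (∨⁺ h))))))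
    uv₁ : T (adj G₁ u v)
    uv₁ = subst T (≡.sym (same-adj₂ u v (¬n₂ ∘ inj₁))) uv₂
    ¬n₁ : ¬ (T (near₁ u) ⊎ T (near₁ v))
    ¬n₁ h = ¬A (∨⁺ (inj₁ (∧⁺ uv₁ (∨⁺ h))))
    uv₀ : T (adj G₀ u v)
    uv₀ = subst T (≡.sym (same-adj₁ u v (¬n₁ ∘ inj₁))) uv₁

  activePair⁻ : ∀ G s u v → T (activePair G s u v) → T (adj G u v) × ¬ T (eliminated G s u) × ¬ T (eliminated G s v)
  activePair⁻ G s u v h with ∧⁻ {adj G u v} h
  ... | uv , h′ with ∧⁻ {active G s u} h′
  ...   | au , av = uv , not⁻ au , not⁻ av

  activePair⁺ : ∀ G s u v → T (adj G u v) → ¬ T (eliminated G s u) → ¬ T (eliminated G s v) → T (activePair G s u v)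
  activePair⁺ G s u v uv au av = ∧⁺ uv (∧⁺ (not⁺ au) (not⁺ av))

  D⁻ : ∀ {u v} → T (D u v) → T (activePair G₀ s₀ u v) × T (stable u) × T (stable v)
  D⁻ {u} {v} h with ∧⁻ {activePair G₀ s₀ u v} h
  ... | act , st = act , ∧⁻ {stable u} st

  elim₁ : ∀ {ℓ₀} → Pos ℓ₀ → ∀ u → T (stable u) → T (eliminated G₀ s₀ u) → T (eliminated G₁ (s₁ ℓ₀) u)
  elim₁ {ℓ₀} pos u st e = proj₁ (Round.eliminated-persists G₀ G₁ o₁ s₀ ℓ₀ pos u (proj₁ (stable⁻ st)) e)

  elim₂ : ∀ {ℓ₀ ℓ₁} → Pos ℓ₁ → ∀ u → T (stable u) → T (eliminated G₁ (s₁ ℓ₀) u) →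
          T (eliminated G₂ (s₂ ℓ₀ ℓ₁) u) × s₂ ℓ₀ ℓ₁ u ≢ Un
  elim₂ {ℓ₀} {ℓ₁} pos u st e = Round.eliminated-persists G₁ G₂ o₂ (s₁ ℓ₀) ℓ₁ pos u (proj₁ (proj₂ (stable⁻ st))) e

  elim₃ : ∀ {ℓ₀ ℓ₁ ℓ₂} → Pos ℓ₂ → ∀ u → T (stable u) → T (eliminated G₂ (s₂ ℓ₀ ℓ₁) u) →
          T (eliminated G₃ (s₃ ℓ₀ ℓ₁ ℓ₂) u)
  elim₃ {ℓ₀} {ℓ₁} {ℓ₂} pos u st e = proj₁ (Round.eliminated-persists G₂ G₃ o₃ (s₂ ℓ₀ ℓ₁) ℓ₂ pos u (proj₂ (proj₂ (stable⁻ st))) e)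

  -- Elimination persists away from changes, so an unaffected edge that is active at the end was
  -- active at the start.
  survives⇒D∨A : ∀ {ℓ₀ ℓ₁ ℓ₂} → Pos ℓ₀ → Pos ℓ₁ → Pos ℓ₂ → ∀ u v → T (survives ℓ₀ ℓ₁ ℓ₂ u v) → T (D u v ∨ A u v)
  survives⇒D∨A {ℓ₀} {ℓ₁} {ℓ₂} pos₀ pos₁ pos₂ u v h with A u v in eqA
  ... | true  = ∨⁺ {D u v} (inj₂ tt)
  ... | false with activePair⁻ G₃ (s₃ ℓ₀ ℓ₁ ℓ₂) u v (proj₁ (∧⁻ {activePair G₃ (s₃ ℓ₀ ℓ₁ ℓ₂) u v} h))
  ...   | uv₃ , au , av with unaffected u v uv₃ (subst T eqA)
  ...     | uv₀ , stu , stv = ∨⁺ (inj₁ (∧⁺ (activePair⁺ G₀ s₀ u v uv₀ (au ∘ elim u stu) (av ∘ elim v stv)) (∧⁺ stu stv)))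
    where
    elim : ∀ u → T (stable u) → T (eliminated G₀ s₀ u) → T (eliminated G₃ (s₃ ℓ₀ ℓ₁ ℓ₂) u)
    elim u st e = elim₃ {ℓ₀} {ℓ₁} pos₂ u st (proj₁ (elim₂ {ℓ₀} pos₁ u st (elim₁ pos₀ u st e)))

  removed⁺ : ∀ ℓ₀ ℓ₁ ℓ₂ u v → T (D u v ∨ A u v) →
             ¬ T (activePair G₃ (s₃ ℓ₀ ℓ₁ ℓ₂) u v) ⊎ ¬ T (untopped ℓ₀ ℓ₁ ℓ₂) → T (removed ℓ₀ ℓ₁ ℓ₂ u v)
  removed⁺ ℓ₀ ℓ₁ ℓ₂ u v DA gone = ∧⁺ DA (not⁺ λ h → let (act , unt) = ∧⁻ {activePair G₃ (s₃ ℓ₀ ℓ₁ ℓ₂) u v} h in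
    [ (λ ¬act → ¬act act) , (λ ¬unt → ¬unt unt) ]′ gone)

  -- The pairs that take part in the competition of round i+2.
  fair : (Fin n → St) → Fin n → Fin n → Bool
  fair s u v = (isUn (s u) ∧ isUn (s v)) ∧ not (nearIn G₂ s u v)

  -- No `In` agent nearby after the first round keeps both ends from becoming `Out` in the second;
  -- none after the second leaves only `Un`.
  quiet-round : ∀ ℓ₀ ℓ₁ → ∀ u v → T (D u v) → ¬ T (nearIn G₁ (s₁ ℓ₀) u v) → ¬ T (nearIn G₂ (s₂ ℓ₀ ℓ₁) u v) → T (fair (s₂ ℓ₀ ℓ₁) u v)
  quiet-round ℓ₀ ℓ₁ u v d no-In₁ no-In₂ with D⁻ d
  ... | _ , stu , stv = ∧⁺ (∧⁺
          (isUn⁺ (un u stu (λ x u~x → ∨⁺ (inj₁ u~x)) (λ x u~x → ∨⁺ (inj₁ u~x))))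
          (isUn⁺ (un v stv (λ x v~x → ∨⁺ {closed G₁ u x} (inj₂ v~x)) (λ x v~x → ∨⁺ {closed G₂ u x} (inj₂ v~x)))))
          (not⁺ no-In₂)
    where
    un : ∀ w → T (stable w) → (∀ x → T (closed G₁ w x) → T (closed G₁ u x ∨ closed G₁ v x)) →
         (∀ x → T (closed G₂ w x) → T (closed G₂ u x ∨ closed G₂ v x)) → s₂ ℓ₀ ℓ₁ w ≡ Un
    un w st ball₁ ball₂ = Round.quiet⇒Un G₁ G₂ o₂ (s₁ ℓ₀) ℓ₁ w (proj₁ (proj₂ (stable⁻ st)))
      (λ x w~x x-In → no-In₁ (nearIn⁺ G₁ (s₁ ℓ₀) u v x (ball₁ x w~x) x-In))
      (λ w-In → no-In₂ (nearIn⁺ G₂ (s₂ ℓ₀ ℓ₁) u v w (ball₂ w (closed-self G₂ w)) w-In))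

  -- An unfair pair in `D` has an `In` agent nearby after the first round or, failing that, after
  -- the second. Either case settles the pair with conditional probability at least ½, and
  -- elimination persists to the end. The cases are disjoint, so the factor 2 is paid only once.
  unfair≤removed : ∀ u v →
    𝔼 L (λ ℓ₀ → 𝔼 L (λ ℓ₁ → ⟦ D u v ∧ not (fair (s₂ ℓ₀ ℓ₁) u v) ⟧)) ≤ 2ℚ * E₃ (λ ℓ₀ ℓ₁ ℓ₂ → ⟦ removed ℓ₀ ℓ₁ ℓ₂ u v ⟧)
  unfair≤removed u v with D u v in eqD
  ... | false = ≤-trans (≤-reflexive (≡.trans (𝔼-cong {n} L (λ _ → 𝔼-const {n} L 0ℚ)) (𝔼-const {n} L 0ℚ)))
                  (0≤* 0≤2 (0≤𝔼 L (λ ℓ₀ _ → 0≤𝔼 L (λ ℓ₁ _ → 0≤𝔼 L (λ ℓ₂ _ → 0≤⟦ A u v ∧ not (survives ℓ₀ ℓ₁ ℓ₂ u v) ⟧)))))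
  ... | true  = begin
    𝔼 L (λ ℓ₀ → 𝔼 L (λ ℓ₁ → ⟦ not (fair (s₂ ℓ₀ ℓ₁) u v) ⟧))
      ≤⟨ 𝔼-mono L (λ ℓ₀ _ → 𝔼-mono L (λ ℓ₁ _ → unfair ℓ₀ ℓ₁)) ⟩
    𝔼 L (λ ℓ₀ → 𝔼 L (λ ℓ₁ → ⟦ c₁ ℓ₀ ⟧ + ⟦ not (c₁ ℓ₀) ∧ c₂ ℓ₀ ℓ₁ ⟧))
      ≡⟨ 𝔼-cong L (λ ℓ₀ → ≡.trans (𝔼-+ L (λ _ → ⟦ c₁ ℓ₀ ⟧) (λ ℓ₁ → ⟦ not (c₁ ℓ₀) ∧ c₂ ℓ₀ ℓ₁ ⟧)) (cong (_+ 𝔼 L (λ ℓ₁ → ⟦ not (c₁ ℓ₀) ∧ c₂ ℓ₀ ℓ₁ ⟧)) (𝔼-const {n} L ⟦ c₁ ℓ₀ ⟧))) ⟩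
    𝔼 L (λ ℓ₀ → ⟦ c₁ ℓ₀ ⟧ + 𝔼 L (λ ℓ₁ → ⟦ not (c₁ ℓ₀) ∧ c₂ ℓ₀ ℓ₁ ⟧))
      ≡⟨ 𝔼-+ L (λ ℓ₀ → ⟦ c₁ ℓ₀ ⟧) (λ ℓ₀ → 𝔼 L (λ ℓ₁ → ⟦ not (c₁ ℓ₀) ∧ c₂ ℓ₀ ℓ₁ ⟧)) ⟩
    𝔼 L (λ ℓ₀ → ⟦ c₁ ℓ₀ ⟧) + 𝔼 L (λ ℓ₀ → 𝔼 L (λ ℓ₁ → ⟦ not (c₁ ℓ₀) ∧ c₂ ℓ₀ ℓ₁ ⟧))
      ≤⟨ +-mono-≤ (nearIn-half G₀ G₁ o₁ s₀ L u v (proj₁ (stable⁻ stu)) (proj₁ (stable⁻ stv)))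
                  (𝔼-mono L (λ ℓ₀ _ → second ℓ₀)) ⟩
    2ℚ * 𝔼 L (λ ℓ₀ → ⟦ g₁ ℓ₀ ⟧) + 𝔼 L (λ ℓ₀ → 2ℚ * 𝔼 L (λ ℓ₁ → ⟦ g₂ ℓ₀ ℓ₁ ⟧))
      ≡⟨ cong (2ℚ * 𝔼 L (λ ℓ₀ → ⟦ g₁ ℓ₀ ⟧) +_) (𝔼-* L 2ℚ (λ ℓ₀ → 𝔼 L (λ ℓ₁ → ⟦ g₂ ℓ₀ ℓ₁ ⟧))) ⟩
    2ℚ * 𝔼 L (λ ℓ₀ → ⟦ g₁ ℓ₀ ⟧) + 2ℚ * 𝔼 L (λ ℓ₀ → 𝔼 L (λ ℓ₁ → ⟦ g₂ ℓ₀ ℓ₁ ⟧))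
      ≡⟨ *-distribˡ-+ 2ℚ (𝔼 L (λ ℓ₀ → ⟦ g₁ ℓ₀ ⟧)) (𝔼 L (λ ℓ₀ → 𝔼 L (λ ℓ₁ → ⟦ g₂ ℓ₀ ℓ₁ ⟧))) ⟨
    2ℚ * (𝔼 L (λ ℓ₀ → ⟦ g₁ ℓ₀ ⟧) + 𝔼 L (λ ℓ₀ → 𝔼 L (λ ℓ₁ → ⟦ g₂ ℓ₀ ℓ₁ ⟧)))
      ≡⟨ cong (2ℚ *_) (𝔼-+ L (λ ℓ₀ → ⟦ g₁ ℓ₀ ⟧) (λ ℓ₀ → 𝔼 L (λ ℓ₁ → ⟦ g₂ ℓ₀ ℓ₁ ⟧))) ⟨
    2ℚ * 𝔼 L (λ ℓ₀ → ⟦ g₁ ℓ₀ ⟧ + 𝔼 L (λ ℓ₁ → ⟦ g₂ ℓ₀ ℓ₁ ⟧))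
      ≡⟨ cong (2ℚ *_) (𝔼-cong L (λ ℓ₀ → cong (_+ 𝔼 L (λ ℓ₁ → ⟦ g₂ ℓ₀ ℓ₁ ⟧)) (𝔼-const {n} L ⟦ g₁ ℓ₀ ⟧))) ⟨
    2ℚ * 𝔼 L (λ ℓ₀ → 𝔼 {n} L (λ _ → ⟦ g₁ ℓ₀ ⟧) + 𝔼 L (λ ℓ₁ → ⟦ g₂ ℓ₀ ℓ₁ ⟧))
      ≡⟨ cong (2ℚ *_) (𝔼-cong L (λ ℓ₀ → 𝔼-+ L (λ _ → ⟦ g₁ ℓ₀ ⟧) (λ ℓ₁ → ⟦ g₂ ℓ₀ ℓ₁ ⟧))) ⟨
    2ℚ * 𝔼 L (λ ℓ₀ → 𝔼 L (λ ℓ₁ → ⟦ g₁ ℓ₀ ⟧ + ⟦ g₂ ℓ₀ ℓ₁ ⟧))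
      ≡⟨ cong (2ℚ *_) (𝔼-cong L (λ ℓ₀ → 𝔼-cong L (λ ℓ₁ → 𝔼-const {n} L (⟦ g₁ ℓ₀ ⟧ + ⟦ g₂ ℓ₀ ℓ₁ ⟧)))) ⟨
    2ℚ * E₃ (λ ℓ₀ ℓ₁ _ → ⟦ g₁ ℓ₀ ⟧ + ⟦ g₂ ℓ₀ ℓ₁ ⟧)
      ≤⟨ *-monoˡ-≤ 0≤2 (𝔼-mono L (λ ℓ₀ pos₀ → 𝔼-mono L (λ ℓ₁ pos₁ → 𝔼-mono L (λ ℓ₂ pos₂ →
           ≤-trans (disjoint (c₁ ℓ₀) (settled G₀ G₁ o₁ s₀ L u v ℓ₀) (c₂ ℓ₀ ℓ₁ ∧ settled G₁ G₂ o₂ (s₁ ℓ₀) L u v ℓ₁))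
                   (⟦⟧-mono {_} {not (survives ℓ₀ ℓ₁ ℓ₂ u v)} (gone pos₀ pos₁ pos₂)))))) ⟩
    2ℚ * E₃ (λ ℓ₀ ℓ₁ ℓ₂ → ⟦ not (survives ℓ₀ ℓ₁ ℓ₂ u v) ⟧) ∎
    where
    open ≤-Reasoning
    TD : T (D u v)
    TD = subst T (≡.sym eqD) tt
    stu : T (stable u)
    stu = proj₁ (proj₂ (D⁻ TD))
    stv : T (stable v)
    stv = proj₂ (proj₂ (D⁻ TD))
    c₁ g₁ : Assign → Bool
    c₁ ℓ₀ = nearIn G₁ (s₁ ℓ₀) u v
    g₁ ℓ₀ = c₁ ℓ₀ ∧ settled G₀ G₁ o₁ s₀ L u v ℓ₀
    c₂ g₂ : Assign → Assign → Bool
    c₂ ℓ₀ ℓ₁ = nearIn G₂ (s₂ ℓ₀ ℓ₁) u v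
    g₂ ℓ₀ ℓ₁ = not (c₁ ℓ₀) ∧ c₂ ℓ₀ ℓ₁ ∧ settled G₁ G₂ o₂ (s₁ ℓ₀) L u v ℓ₁

    unfair : ∀ ℓ₀ ℓ₁ → ⟦ not (fair (s₂ ℓ₀ ℓ₁) u v) ⟧ ≤ ⟦ c₁ ℓ₀ ⟧ + ⟦ not (c₁ ℓ₀) ∧ c₂ ℓ₀ ℓ₁ ⟧
    unfair ℓ₀ ℓ₁ with c₁ ℓ₀ in eq₁
    ... | true  = ≤-trans (⟦⟧≤1 (not (fair (s₂ ℓ₀ ℓ₁) u v))) (p≤p+q {1ℚ} {0ℚ} ≤-refl)
    ... | false = ≤-trans (⟦⟧-mono {not (fair (s₂ ℓ₀ ℓ₁) u v)} {c₂ ℓ₀ ℓ₁} λ ¬fair → hit (not⁻ ¬fair))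
                    (≤-reflexive (≡.sym (+-identityˡ ⟦ c₂ ℓ₀ ℓ₁ ⟧)))
      where
      hit : ¬ T (fair (s₂ ℓ₀ ℓ₁) u v) → T (c₂ ℓ₀ ℓ₁)
      hit ¬fair = decidable-stable (T? (c₂ ℓ₀ ℓ₁)) λ ¬c₂ → ¬fair (quiet-round ℓ₀ ℓ₁ u v TD (subst T eq₁) ¬c₂)

    second : ∀ ℓ₀ → 𝔼 L (λ ℓ₁ → ⟦ not (c₁ ℓ₀) ∧ c₂ ℓ₀ ℓ₁ ⟧) ≤ 2ℚ * 𝔼 L (λ ℓ₁ → ⟦ g₂ ℓ₀ ℓ₁ ⟧)
    second ℓ₀ with c₁ ℓ₀
    ... | true  = ≤-trans (≤-reflexive (𝔼-const {n} L 0ℚ)) (0≤* 0≤2 (≤-reflexive (≡.sym (𝔼-const {n} L 0ℚ))))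
    ... | false = nearIn-half G₁ G₂ o₂ (s₁ ℓ₀) L u v (proj₁ (proj₂ (stable⁻ stu))) (proj₁ (proj₂ (stable⁻ stv)))

    disjoint : ∀ c a b → ⟦ c ∧ a ⟧ + ⟦ not c ∧ b ⟧ ≤ ⟦ (c ∧ a) ∨ (not c ∧ b) ⟧
    disjoint false a     b = ≤-reflexive (+-identityˡ ⟦ b ⟧)
    disjoint true  false b = ≤-refl
    disjoint true  true  b = ≤-refl

    gone : ∀ {ℓ₀ ℓ₁ ℓ₂} → Pos ℓ₀ → Pos ℓ₁ → Pos ℓ₂ → T (g₁ ℓ₀ ∨ g₂ ℓ₀ ℓ₁) → T (not (survives ℓ₀ ℓ₁ ℓ₂ u v))
    gone {ℓ₀} {ℓ₁} {ℓ₂} pos₀ pos₁ pos₂ h = not⁺ λ alive →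
      let (act , unt) = ∧⁻ {activePair G₃ (s₃ ℓ₀ ℓ₁ ℓ₂) u v} alive
          (_ , au , av) = activePair⁻ G₃ (s₃ ℓ₀ ℓ₁ ℓ₂) u v act
          (unt₀ , unt₁₂) = ∧⁻ {not (topped L ℓ₀)} unt
          (unt₁ , _) = ∧⁻ {not (topped L ℓ₁)} unt₁₂
          late : ∀ w → T (stable w) → T (eliminated G₂ (s₂ ℓ₀ ℓ₁) w) → T (eliminated G₃ (s₃ ℓ₀ ℓ₁ ℓ₂) w)
          late w st e = elim₃ {ℓ₀} {ℓ₁} pos₂ w st e
          early : ∀ w → T (stable w) → T (eliminated G₁ (s₁ ℓ₀) w) → T (eliminated G₃ (s₃ ℓ₀ ℓ₁ ℓ₂) w)
          early w st e = late w st (proj₁ (elim₂ {ℓ₀} pos₁ w st e))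
          first : T (settled G₀ G₁ o₁ s₀ L u v ℓ₀) → ⊥
          first st = [ (λ e → [ au ∘ early u stu , av ∘ early v stv ]′ (∨⁻ {eliminated G₁ (s₁ ℓ₀) u} e)) , not⁻ unt₀ ]′
                       (∨⁻ {eliminated G₁ (s₁ ℓ₀) u ∨ eliminated G₁ (s₁ ℓ₀) v} st)
          then : T (settled G₁ G₂ o₂ (s₁ ℓ₀) L u v ℓ₁) → ⊥
          then st = [ (λ e → [ au ∘ late u stu , av ∘ late v stv ]′ (∨⁻ {eliminated G₂ (s₂ ℓ₀ ℓ₁) u} e)) , not⁻ unt₁ ]′
                      (∨⁻ {eliminated G₂ (s₂ ℓ₀ ℓ₁) u ∨ eliminated G₂ (s₂ ℓ₀ ℓ₁) v} st)
      in [ (λ g → first (proj₂ (∧⁻ {c₁ ℓ₀} g))) , (λ g → then (proj₂ (∧⁻ {c₂ ℓ₀ ℓ₁} (proj₂ (∧⁻ {not (c₁ ℓ₀)} g))))) ]′ (∨⁻ {g₁ ℓ₀} h)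

  module _ (ℓ₀ ℓ₁ : Assign) (pos₀ : Pos ℓ₀) (pos₁ : Pos ℓ₁) where
    private
      t : Fin n → St
      t = s₂ ℓ₀ ℓ₁
      a p : Fin n → Fin n → Bool
      a u x = adj G₂ u x ∧ isUn (t x)
      p u v = D u v ∧ fair t u v

    a-irrefl : ∀ v → a v v ≡ false
    a-irrefl v = cong (_∧ isUn (t v)) (adj-irrefl G₂ v)

    fair⁻ : ∀ {u v} → T (fair t u v) → t u ≡ Un × t v ≡ Un × ¬ T (nearIn G₂ t u v)
    fair⁻ {u} {v} h with ∧⁻ {isUn (t u) ∧ isUn (t v)} h
    ... | uns , no-In with ∧⁻ {isUn (t u)} uns
    ...   | u-Un , v-Un = isUn⁻ u-Un , isUn⁻ v-Un , not⁻ no-In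

    D⇒adj₂ : ∀ u v → T (D u v) → T (adj G₂ u v)
    D⇒adj₂ u v d with D⁻ d
    ... | act , stu , _ = subst T (≡.trans (same-adj₁ u v (proj₁ (stable⁻ stu))) (same-adj₂ u v (proj₁ (proj₂ (stable⁻ stu)))))
                            (proj₁ (activePair⁻ G₀ s₀ u v act))

    p⇒a : ∀ u v → T (p u v) → T (a u v)
    p⇒a u v h with ∧⁻ {D u v} h
    ... | d , f = ∧⁺ (D⇒adj₂ u v d) (isUn⁺ (proj₁ (proj₂ (fair⁻ f))))

    p-sym : ∀ u v → T (p u v) → T (p v u)
    p-sym u v h with ∧⁻ {D u v} h
    ... | d , f with D⁻ d | fair⁻ f
    ...   | act , stu , stv | u-Un , v-Un , no-In with activePair⁻ G₀ s₀ u v act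
    ...     | uv , au , av = ∧⁺ (∧⁺ (activePair⁺ G₀ s₀ v u (subst T (adj-sym G₀ u v) uv) av au) (∧⁺ stv stu))
                               (∧⁺ (∧⁺ (isUn⁺ v-Un) (isUn⁺ u-Un)) (not⁺ (no-In ∘ nearIn-sym G₂ t v u)))

    -- By fairness `v` is a candidate, and it wins strictly against its `Un` neighbours, so `u` is
    -- eliminated and with it every pair at `u`. If the pair with `x` is unaffected, it lies in `D`:
    -- an `x` eliminated at the start could not be `Un` now.
    removes : ∀ ℓ₂ → Pos ℓ₂ → ∀ u v x → T (p u v) → T (beats a u v ℓ₂) → T (a u x) → T (removed ℓ₀ ℓ₁ ℓ₂ u x)
    removes ℓ₂ pos₂ u v x h beaten ux∧Un with ∧⁻ {D u v} h | ∧⁻ {adj G₂ u x} ux∧Un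
    ... | d , f | ux₂ , x-Un with D⁻ d | fair⁻ f
    ...   | act , stu , stv | u-Un , v-Un , no-In =
      removed⁺ ℓ₀ ℓ₁ ℓ₂ u x D∨A (inj₁ λ act₃ → proj₁ (proj₂ (activePair⁻ G₃ (s₃ ℓ₀ ℓ₁ ℓ₂) u x act₃)) u-eliminated)
      where
      ¬n₃ : ¬ T (near₃ u)
      ¬n₃ = proj₂ (proj₂ (stable⁻ stu))
      u~v : T (closed G₃ u v)
      u~v = closed-adj G₃ u v (subst T (same-adj₃ u v ¬n₃) (D⇒adj₂ u v d))
      strict : ∀ y → T (adj G₂ v y) → t y ≡ t v → ℓ₂ y ℕ.< ℓ₂ v
      strict y vy ty≡tv = beats⁻ a u v ℓ₂ y beaten (λ { refl → subst T (adj-irrefl G₂ y) vy })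
                            (∨⁺ {a u y} (inj₂ (∧⁺ vy (isUn⁺ (≡.trans ty≡tv v-Un)))))
      u-eliminated : T (eliminated G₃ (s₃ ℓ₀ ℓ₁ ℓ₂) u)
      u-eliminated = eliminated⁺ G₃ (s₃ ℓ₀ ℓ₁ ℓ₂) u v u~v
        (Round.strict⇒InNoIn G₂ G₃ o₃ t ℓ₂ pos₂ v (Round.calm G₂ G₃ o₃ t u ¬n₃ v u~v)
          (inj₂ (v-Un , λ y vy y-In → no-In (nearIn⁺ G₂ t u v y (∨⁺ {closed G₂ u y} (inj₂ (closed-adj G₂ v y vy))) y-In)))
          strict)
      D∨A : T (D u x ∨ A u x)
      D∨A with T? (A u x)
      ... | yes Aux = ∨⁺ {D u x} (inj₂ Aux)
      ... | no ¬Aux with unaffected u x (subst T (same-adj₃ u x ¬n₃) ux₂) ¬Aux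
      ...   | ux₀ , _ , stx = ∨⁺ (inj₁ (∧⁺ (activePair⁺ G₀ s₀ u x ux₀ (proj₁ (proj₂ (activePair⁻ G₀ s₀ u v act)))
                (λ e → proj₂ (elim₂ {ℓ₀} pos₁ x stx (elim₁ pos₀ x stx e)) (isUn⁻ x-Un))) (∧⁺ stu stx)))

    fair≤removed : ∑∑ (λ u v → ⟦ D u v ∧ fair t u v ⟧) ≤ 5ℚ * 𝔼 L (λ ℓ₂ → ∑∑ (λ u x → ⟦ removed ℓ₀ ℓ₁ ℓ₂ u x ⟧))
    fair≤removed = pairs≤removed a p (removed ℓ₀ ℓ₁) a-irrefl p⇒a p-sym removes (ℕ.m≤n+m (3 ℕ.+ (n ℕ.+ n)) N)

  -- Combining the estimates

  d α e X Y : ℚ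
  d = ∑∑ (λ u v → ⟦ D u v ⟧)
  α = ℕtoℚ (affectedUnion G₀ G₁ o₁ G₂ o₂ G₃ o₃)
  e = ℕtoℚ (activeEdges G₀ s₀)
  X = E₃ (λ ℓ₀ ℓ₁ ℓ₂ → ∑∑ (λ u v → ⟦ removed ℓ₀ ℓ₁ ℓ₂ u v ⟧))
  Y = E₃ (λ ℓ₀ ℓ₁ ℓ₂ → ∑∑ (λ u v → ⟦ survives ℓ₀ ℓ₁ ℓ₂ u v ⟧))

  7ℚ : ℚ
  7ℚ = ℤ.+ 7 / 1

  ∑∑-E₃ : (f : Fin n → Fin n → Assign → Assign → Assign → ℚ) →
          ∑∑ (λ u v → E₃ (λ ℓ₀ ℓ₁ ℓ₂ → f u v ℓ₀ ℓ₁ ℓ₂)) ≡ E₃ (λ ℓ₀ ℓ₁ ℓ₂ → ∑∑ (λ u v → f u v ℓ₀ ℓ₁ ℓ₂))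
  ∑∑-E₃ f = ≡.sym (≡.trans (𝔼-cong L (λ ℓ₀ → ≡.trans (𝔼-cong L (λ ℓ₁ → 𝔼-∑∑ L (λ u v → f u v ℓ₀ ℓ₁)))
    (𝔼-∑∑ L (λ u v ℓ₁ → 𝔼 L (f u v ℓ₀ ℓ₁))))) (𝔼-∑∑ L (λ u v ℓ₀ → 𝔼 L (λ ℓ₁ → 𝔼 L (f u v ℓ₀ ℓ₁)))))

  E₂ : (Assign → Assign → ℚ) → ℚ
  E₂ f = 𝔼 L (λ ℓ₀ → 𝔼 L (f ℓ₀))

  -- Split the pairs of `D` by fairness after two rounds: the unfair ones cost the factor 2, the
  -- fair ones the factor 5.
  d≤7X : d ≤ 7ℚ * X
  d≤7X = begin
    d                                                             ≡⟨ E₂-const d ⟨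
    E₂ (λ _ _ → d)                                                ≡⟨ 𝔼-cong L (λ ℓ₀ → 𝔼-cong L (λ ℓ₁ → split ℓ₀ ℓ₁)) ⟩
    E₂ (λ ℓ₀ ℓ₁ → unfair ℓ₀ ℓ₁ + fairly ℓ₀ ℓ₁)                    ≡⟨ 𝔼-cong L (λ ℓ₀ → 𝔼-+ L (unfair ℓ₀) (fairly ℓ₀)) ⟩
    𝔼 L (λ ℓ₀ → 𝔼 L (unfair ℓ₀) + 𝔼 L (fairly ℓ₀))             ≡⟨ 𝔼-+ L (λ ℓ₀ → 𝔼 L (unfair ℓ₀)) (λ ℓ₀ → 𝔼 L (fairly ℓ₀)) ⟩
    E₂ unfair + E₂ fairly                                         ≤⟨ +-mono-≤ unfair≤ fairly≤ ⟩
    2ℚ * X + 5ℚ * X                                               ≡⟨ *-distribʳ-+ X 2ℚ 5ℚ ⟨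
    7ℚ * X                                                        ∎
    where
    open ≤-Reasoning
    E₂-const : ∀ c → E₂ (λ _ _ → c) ≡ c
    E₂-const c = ≡.trans (𝔼-cong {n} L (λ _ → 𝔼-const {n} L c)) (𝔼-const {n} L c)
    unfair fairly : Assign → Assign → ℚ
    unfair ℓ₀ ℓ₁ = ∑∑ (λ u v → ⟦ D u v ∧ not (fair (s₂ ℓ₀ ℓ₁) u v) ⟧)
    fairly ℓ₀ ℓ₁ = ∑∑ (λ u v → ⟦ D u v ∧ fair (s₂ ℓ₀ ℓ₁) u v ⟧)
    ∧-split : ∀ a b → ⟦ a ⟧ ≡ ⟦ a ∧ not b ⟧ + ⟦ a ∧ b ⟧
    ∧-split false b     = refl
    ∧-split true  false = refl
    ∧-split true  true  = refl
    split : ∀ ℓ₀ ℓ₁ → d ≡ unfair ℓ₀ ℓ₁ + fairly ℓ₀ ℓ₁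
    split ℓ₀ ℓ₁ = ≡.trans (∑∑-cong (λ u v → ∧-split (D u v) (fair (s₂ ℓ₀ ℓ₁) u v)))
      (∑∑-+ (λ u v → ⟦ D u v ∧ not (fair (s₂ ℓ₀ ℓ₁) u v) ⟧) (λ u v → ⟦ D u v ∧ fair (s₂ ℓ₀ ℓ₁) u v ⟧))
    unfair≤ : E₂ unfair ≤ 2ℚ * X
    unfair≤ = begin
      E₂ unfair
        ≡⟨ 𝔼-cong L (λ ℓ₀ → 𝔼-∑∑ L (λ u v ℓ₁ → ⟦ D u v ∧ not (fair (s₂ ℓ₀ ℓ₁) u v) ⟧)) ⟩
      𝔼 L (λ ℓ₀ → ∑∑ (λ u v → 𝔼 L (λ ℓ₁ → ⟦ D u v ∧ not (fair (s₂ ℓ₀ ℓ₁) u v) ⟧)))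
        ≡⟨ 𝔼-∑∑ L (λ u v ℓ₀ → 𝔼 L (λ ℓ₁ → ⟦ D u v ∧ not (fair (s₂ ℓ₀ ℓ₁) u v) ⟧)) ⟩
      ∑∑ (λ u v → E₂ (λ ℓ₀ ℓ₁ → ⟦ D u v ∧ not (fair (s₂ ℓ₀ ℓ₁) u v) ⟧))
        ≤⟨ ∑∑-mono unfair≤removed ⟩
      ∑∑ (λ u v → 2ℚ * E₃ (λ ℓ₀ ℓ₁ ℓ₂ → ⟦ removed ℓ₀ ℓ₁ ℓ₂ u v ⟧))
        ≡⟨ ∑∑-* 2ℚ (λ u v → E₃ (λ ℓ₀ ℓ₁ ℓ₂ → ⟦ removed ℓ₀ ℓ₁ ℓ₂ u v ⟧)) ⟩
      2ℚ * ∑∑ (λ u v → E₃ (λ ℓ₀ ℓ₁ ℓ₂ → ⟦ removed ℓ₀ ℓ₁ ℓ₂ u v ⟧))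
        ≡⟨ cong (2ℚ *_) (∑∑-E₃ (λ u v ℓ₀ ℓ₁ ℓ₂ → ⟦ removed ℓ₀ ℓ₁ ℓ₂ u v ⟧)) ⟩
      2ℚ * X ∎
    R₂ : Assign → Assign → ℚ
    R₂ ℓ₀ ℓ₁ = 𝔼 L (λ ℓ₂ → ∑∑ (λ u v → ⟦ removed ℓ₀ ℓ₁ ℓ₂ u v ⟧))
    fairly≤ : E₂ fairly ≤ 5ℚ * X
    fairly≤ = begin
      E₂ fairly                                      ≤⟨ 𝔼-mono L (λ ℓ₀ pos₀ → 𝔼-mono L (λ ℓ₁ pos₁ → fair≤removed ℓ₀ ℓ₁ pos₀ pos₁)) ⟩
      E₂ (λ ℓ₀ ℓ₁ → 5ℚ * R₂ ℓ₀ ℓ₁)                   ≡⟨ 𝔼-cong L (λ ℓ₀ → 𝔼-* L 5ℚ (R₂ ℓ₀)) ⟩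
      𝔼 L (λ ℓ₀ → 5ℚ * 𝔼 L (R₂ ℓ₀))                ≡⟨ 𝔼-* L 5ℚ (λ ℓ₀ → 𝔼 L (R₂ ℓ₀)) ⟩
      5ℚ * X                                         ∎

  activePair-sym : ∀ G s u v → activePair G s u v ≡ activePair G s v u
  activePair-sym G s u v = cong₂ _∧_ (adj-sym G u v) (∧-comm (active G s u) (active G s v))

  activePair-irrefl : ∀ G s v → activePair G s v v ≡ false
  activePair-irrefl G s v = cong (_∧ active G s v ∧ active G s v) (adj-irrefl G v)

  -- `d`, `X` and `Y` count ordered pairs, whereas `e` and `α` count each edge once.
  d≤2e : d ≤ e + e
  d≤2e = ≤-trans (∑∑-mono (λ u v → ⟦⟧-mono {D u v} {activePair G₀ s₀ u v} (λ h → proj₁ (D⁻ {u} {v} h))))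
    (≤-reflexive (∑∑-pairs (activePair G₀ s₀) (activePair-sym G₀ s₀) (activePair-irrefl G₀ s₀)))

  A≡2α : ∑∑ (λ u v → ⟦ A u v ⟧) ≡ α + α
  A≡2α = ∑∑-pairs A
    (λ u v → cong₂ _∨_ (affected-sym G₀ G₁ o₁ u v) (cong₂ _∨_ (affected-sym G₁ G₂ o₂ u v) (affected-sym G₂ G₃ o₃ u v)))
    (λ v → cong₂ _∨_ (affected-irrefl G₀ G₁ o₁ v) (cong₂ _∨_ (affected-irrefl G₁ G₂ o₂ v) (affected-irrefl G₂ G₃ o₃ v)))
    where
    affected-sym : ∀ (Gp Gn : Graph n) o u v → affected Gp Gn o u v ≡ affected Gp Gn o v u
    affected-sym Gp Gn o u v = cong₂ _∧_ (adj-sym Gn u v) (∨-comm (nearChanged Gp Gn o u) (nearChanged Gp Gn o v))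
    affected-irrefl : ∀ (Gp Gn : Graph n) o v → affected Gp Gn o v v ≡ false
    affected-irrefl Gp Gn o v = cong (_∧ (nearChanged Gp Gn o v ∨ nearChanged Gp Gn o v)) (adj-irrefl Gn v)

  E₃-mono : ∀ {f g} → (∀ {ℓ₀ ℓ₁ ℓ₂} → Pos ℓ₀ → Pos ℓ₁ → Pos ℓ₂ → f ℓ₀ ℓ₁ ℓ₂ ≤ g ℓ₀ ℓ₁ ℓ₂) → E₃ f ≤ E₃ g
  E₃-mono f≤g = 𝔼-mono L (λ ℓ₀ pos₀ → 𝔼-mono L (λ ℓ₁ pos₁ → 𝔼-mono L (λ ℓ₂ pos₂ → f≤g pos₀ pos₁ pos₂)))

  -- Surviving and removed pairs are disjoint, and both kinds lie in the union of `D` and `A`.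
  Y+X≤d+2α : Y + X ≤ d + (α + α)
  Y+X≤d+2α = begin
    Y + X
      ≡⟨ E₃-+ (λ ℓ₀ ℓ₁ ℓ₂ → S ℓ₀ ℓ₁ ℓ₂) (λ ℓ₀ ℓ₁ ℓ₂ → R ℓ₀ ℓ₁ ℓ₂) ⟨
    E₃ (λ ℓ₀ ℓ₁ ℓ₂ → S ℓ₀ ℓ₁ ℓ₂ + R ℓ₀ ℓ₁ ℓ₂)
      ≤⟨ E₃-mono (λ {ℓ₀} {ℓ₁} {ℓ₂} → pointwise {ℓ₀} {ℓ₁} {ℓ₂}) ⟩
    E₃ (λ _ _ _ → d + (α + α))
      ≡⟨ ≡.trans (𝔼-cong {n} L (λ _ → ≡.trans (𝔼-cong {n} L (λ _ → 𝔼-const {n} L (d + (α + α)))) (𝔼-const {n} L (d + (α + α))))) (𝔼-const {n} L (d + (α + α))) ⟩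
    d + (α + α) ∎
    where
    open ≤-Reasoning
    S R : Assign → Assign → Assign → ℚ
    S ℓ₀ ℓ₁ ℓ₂ = ∑∑ (λ u v → ⟦ survives ℓ₀ ℓ₁ ℓ₂ u v ⟧)
    R ℓ₀ ℓ₁ ℓ₂ = ∑∑ (λ u v → ⟦ removed ℓ₀ ℓ₁ ℓ₂ u v ⟧)
    E₃-+ : ∀ f g → E₃ (λ ℓ₀ ℓ₁ ℓ₂ → f ℓ₀ ℓ₁ ℓ₂ + g ℓ₀ ℓ₁ ℓ₂) ≡ E₃ f + E₃ g
    E₃-+ f g = ≡.trans (𝔼-cong L (λ ℓ₀ → ≡.trans (𝔼-cong L (λ ℓ₁ → 𝔼-+ L (f ℓ₀ ℓ₁) (g ℓ₀ ℓ₁)))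
      (𝔼-+ L (λ ℓ₁ → 𝔼 L (f ℓ₀ ℓ₁)) (λ ℓ₁ → 𝔼 L (g ℓ₀ ℓ₁)))))
      (𝔼-+ L (λ ℓ₀ → 𝔼 L (λ ℓ₁ → 𝔼 L (f ℓ₀ ℓ₁))) (λ ℓ₀ → 𝔼 L (λ ℓ₁ → 𝔼 L (g ℓ₀ ℓ₁))))
    partition : ∀ {x a b} → (T x → T (a ∨ b)) → ⟦ x ⟧ + ⟦ (a ∨ b) ∧ not x ⟧ ≤ ⟦ a ⟧ + ⟦ b ⟧
    partition {true}  {true}  {b}     h = +-monoʳ-≤ 1ℚ 0≤⟦ b ⟧
    partition {true}  {false} {true}  h = ≤-refl
    partition {true}  {false} {false} h = ⊥-elim (h tt)
    partition {false} {true}  {b}     h = ≤-trans (p≤p+q {1ℚ} 0≤⟦ b ⟧) ≤-refl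
    partition {false} {false} {true}  h = ≤-refl
    partition {false} {false} {false} h = ≤-refl
    pointwise : ∀ {ℓ₀ ℓ₁ ℓ₂} → Pos ℓ₀ → Pos ℓ₁ → Pos ℓ₂ → S ℓ₀ ℓ₁ ℓ₂ + R ℓ₀ ℓ₁ ℓ₂ ≤ d + (α + α)
    pointwise {ℓ₀} {ℓ₁} {ℓ₂} pos₀ pos₁ pos₂ = begin
      S ℓ₀ ℓ₁ ℓ₂ + R ℓ₀ ℓ₁ ℓ₂
        ≡⟨ ∑∑-+ (λ u v → ⟦ survives ℓ₀ ℓ₁ ℓ₂ u v ⟧) (λ u v → ⟦ removed ℓ₀ ℓ₁ ℓ₂ u v ⟧) ⟨
      ∑∑ (λ u v → ⟦ survives ℓ₀ ℓ₁ ℓ₂ u v ⟧ + ⟦ removed ℓ₀ ℓ₁ ℓ₂ u v ⟧)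
        ≤⟨ ∑∑-mono (λ u v → partition {survives ℓ₀ ℓ₁ ℓ₂ u v} {D u v} {A u v} (survives⇒D∨A pos₀ pos₁ pos₂ u v)) ⟩
      ∑∑ (λ u v → ⟦ D u v ⟧ + ⟦ A u v ⟧)
        ≡⟨ ∑∑-+ (λ u v → ⟦ D u v ⟧) (λ u v → ⟦ A u v ⟧) ⟩
      d + ∑∑ (λ u v → ⟦ A u v ⟧)
        ≡⟨ cong (d +_) A≡2α ⟩
      d + (α + α) ∎

  -- Inside the box all values are at most `N ≤ L`, so none reaches the cap and every pair active at
  -- the end counts as surviving.
  truncExp3≤½Y : truncExp3 N (λ ℓ₀ ℓ₁ ℓ₂ → activeEdges G₃ (s₃ ℓ₀ ℓ₁ ℓ₂)) ≤ ½ * Y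
  truncExp3≤½Y = begin
    truncExp3 N (λ ℓ₀ ℓ₁ ℓ₂ → activeEdges G₃ (s₃ ℓ₀ ℓ₁ ℓ₂))
      ≡⟨ truncExp3≡ N (λ ℓ₀ ℓ₁ ℓ₂ → activeEdges G₃ (s₃ ℓ₀ ℓ₁ ℓ₂)) ⟩
    truncExp N (λ ℓ₀ → truncExp N (λ ℓ₁ → truncExp N (λ ℓ₂ → ℕtoℚ (activeEdges G₃ (s₃ ℓ₀ ℓ₁ ℓ₂)))))
      ≤⟨ truncExp≤𝔼 N≤L
           (λ ℓ₀ ℓ₀≤N → truncExp≤𝔼 N≤L
             (λ ℓ₁ ℓ₁≤N → truncExp≤𝔼 N≤L
               (λ ℓ₂ ℓ₂≤N → pointwise ℓ₀ ℓ₁ ℓ₂ (∧⁺ (low ℓ₀ ℓ₀≤N) (∧⁺ (low ℓ₁ ℓ₁≤N) (low ℓ₂ ℓ₂≤N))))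
               (λ ℓ₂ → 0≤½S ℓ₀ ℓ₁ ℓ₂))
             (λ ℓ₁ → 0≤𝔼 L (λ ℓ₂ _ → 0≤½S ℓ₀ ℓ₁ ℓ₂)))
           (λ ℓ₀ → 0≤𝔼 L (λ ℓ₁ _ → 0≤𝔼 L (λ ℓ₂ _ → 0≤½S ℓ₀ ℓ₁ ℓ₂))) ⟩
    E₃ (λ ℓ₀ ℓ₁ ℓ₂ → ½ * S ℓ₀ ℓ₁ ℓ₂)
      ≡⟨ ≡.trans (𝔼-cong L (λ ℓ₀ → ≡.trans (𝔼-cong L (λ ℓ₁ → 𝔼-* L ½ (S ℓ₀ ℓ₁))) (𝔼-* L ½ (λ ℓ₁ → 𝔼 L (S ℓ₀ ℓ₁)))))
                 (𝔼-* L ½ (λ ℓ₀ → 𝔼 L (λ ℓ₁ → 𝔼 L (S ℓ₀ ℓ₁)))) ⟩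
    ½ * Y ∎
    where
    open ≤-Reasoning
    N≤L : N ℕ.≤ L
    N≤L = ℕ.m≤m+n N (3 ℕ.+ (n ℕ.+ n))
    S : Assign → Assign → Assign → ℚ
    S ℓ₀ ℓ₁ ℓ₂ = ∑∑ (λ u v → ⟦ survives ℓ₀ ℓ₁ ℓ₂ u v ⟧)
    0≤½S : ∀ ℓ₀ ℓ₁ ℓ₂ → 0ℚ ≤ ½ * S ℓ₀ ℓ₁ ℓ₂
    0≤½S ℓ₀ ℓ₁ ℓ₂ = 0≤* 0≤½ (0≤sum (λ u → 0≤sum (λ v → 0≤⟦ survives ℓ₀ ℓ₁ ℓ₂ u v ⟧)))
    low : ∀ ℓ → (∀ v → ℓ v ℕ.≤ N) → T (not (topped L ℓ))
    low ℓ ℓ≤N = not⁺ λ h → let (x , top) = any-agent⁻ _ h in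
      ℕ.<⇒≱ (s≤s N≤L) (subst (ℕ._≤ N) (ℕ.≡ᵇ⇒≡ (ℓ x) (suc L) top) (ℓ≤N x))
    pointwise : ∀ ℓ₀ ℓ₁ ℓ₂ → T (untopped ℓ₀ ℓ₁ ℓ₂) → ℕtoℚ (activeEdges G₃ (s₃ ℓ₀ ℓ₁ ℓ₂)) ≤ ½ * S ℓ₀ ℓ₁ ℓ₂
    pointwise ℓ₀ ℓ₁ ℓ₂ unt = begin
      m                                                    ≡⟨ solve 1 (λ x → x := con ½ :* (x :+ x)) refl m ⟩
      ½ * (m + m)                                          ≡⟨ cong (½ *_) (∑∑-pairs Q (activePair-sym G₃ (s₃ ℓ₀ ℓ₁ ℓ₂)) (activePair-irrefl G₃ (s₃ ℓ₀ ℓ₁ ℓ₂))) ⟨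
      ½ * ∑∑ (λ u v → ⟦ Q u v ⟧)                           ≤⟨ *-monoˡ-≤ 0≤½ (∑∑-mono (λ u v → ⟦⟧-mono {Q u v} {survives ℓ₀ ℓ₁ ℓ₂ u v} (λ h → ∧⁺ h unt))) ⟩
      ½ * S ℓ₀ ℓ₁ ℓ₂                                       ∎
      where
      m : ℚ
      m = ℕtoℚ (activeEdges G₃ (s₃ ℓ₀ ℓ₁ ℓ₂))
      Q : Fin n → Fin n → Bool
      Q = activePair G₃ (s₃ ℓ₀ ℓ₁ ℓ₂)

  ½Y≤ : ½ * Y ≤ (ℤ.+ 6 / 7) * e + (ℤ.+ 8 / 7) * α
  ½Y≤ = begin
    -- Adding and subtracting `d` prepares `d ≤ 7ℚ * X`: then `7ℚ * Y` is at most seven times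
    -- `d + 2α`, less `d`, and 1/14 of this is `3/7 d + α`.
    ½ * Y                                                        ≡⟨ solve 2 (λ y d → con ½ :* y := con (ℤ.+ 1 / 14) :* ((con 7ℚ :* y :+ d) :+ :- d)) refl Y d ⟩
    (ℤ.+ 1 / 14) * ((7ℚ * Y + d) + - d)                          ≤⟨ *-monoˡ-≤ (nonNegative⁻¹ (ℤ.+ 1 / 14)) (+-monoˡ-≤ (- d) (+-monoʳ-≤ (7ℚ * Y) d≤7X)) ⟩
    (ℤ.+ 1 / 14) * ((7ℚ * Y + 7ℚ * X) + - d)                     ≡⟨ cong (λ z → (ℤ.+ 1 / 14) * (z + - d)) (*-distribˡ-+ 7ℚ Y X) ⟨
    (ℤ.+ 1 / 14) * (7ℚ * (Y + X) + - d)                          ≤⟨ *-monoˡ-≤ (nonNegative⁻¹ (ℤ.+ 1 / 14)) (+-monoˡ-≤ (- d) (*-monoˡ-≤ (nonNegative⁻¹ 7ℚ) Y+X≤d+2α)) ⟩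
    (ℤ.+ 1 / 14) * (7ℚ * (d + (α + α)) + - d)                    ≡⟨ solve 2 (λ d a → con (ℤ.+ 1 / 14) :* (con 7ℚ :* (d :+ (a :+ a)) :+ :- d) := con (ℤ.+ 3 / 7) :* d :+ a) refl d α ⟩
    -- The coefficient 6/7 comes from `d ≤ 2e`; one further seventh of `α` is added to reach the
    -- stated 8/7.
    (ℤ.+ 3 / 7) * d + α                                          ≤⟨ +-mono-≤ (*-monoˡ-≤ (nonNegative⁻¹ (ℤ.+ 3 / 7)) d≤2e) (p≤p+q (0≤* (nonNegative⁻¹ (ℤ.+ 1 / 7)) 0≤α)) ⟩
    (ℤ.+ 3 / 7) * (e + e) + (α + (ℤ.+ 1 / 7) * α)                ≡⟨ solve 2 (λ e a → con (ℤ.+ 3 / 7) :* (e :+ e) :+ (a :+ con (ℤ.+ 1 / 7) :* a) := con (ℤ.+ 6 / 7) :* e :+ con (ℤ.+ 8 / 7) :* a) refl e α ⟩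
    (ℤ.+ 6 / 7) * e + (ℤ.+ 8 / 7) * α                            ∎
    where
    open ≤-Reasoning
    0≤α : 0ℚ ≤ α
    0≤α = 0≤ℕtoℚ (affectedUnion G₀ G₁ o₁ G₂ o₂ G₃ o₃)

open import Data.Integer using (+_)

theorem2 : (n : ℕ) (G₀ : Graph n) (s₀ : Fin n → St)
           (G₁ : Graph n) (o₁ : Fin n → Maybe St)
           (G₂ : Graph n) (o₂ : Fin n → Maybe St)
           (G₃ : Graph n) (o₃ : Fin n → Maybe St) →
           (N : ℕ) →
           truncExp3 N (λ ℓ₀ ℓ₁ ℓ₂ →
               activeEdges G₃ (state3 G₀ s₀ G₁ o₁ G₂ o₂ G₃ o₃ ℓ₀ ℓ₁ ℓ₂))
             ≤ (+ 6 / 7) * ℕtoℚ (activeEdges G₀ s₀)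
               + (+ 8 / 7) * ℕtoℚ (affectedUnion G₀ G₁ o₁ G₂ o₂ G₃ o₃)
theorem2 n G₀ s₀ G₁ o₁ G₂ o₂ G₃ o₃ N = ≤-trans truncExp3≤½Y ½Y≤
  where open Main n G₀ s₀ G₁ o₁ G₂ o₂ G₃ o₃ N
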